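{- Let $G=(V,E)$ be a finite undirected graph with $p=|V|$ vertices, and let $\sigma: V\to\{1,\dots,p\}$ be an ordering of its vertices (a bijection). Then the following statements are equivalent. 1. $G$ is a homogeneous graph and $\sigma$ is a Hasse tree based elimination scheme for $G$. 2. For every $p\times p$ diagonal matrix $D$ with positive diagonal entries and every $p\times p$ real lower triangular matrix $L$ with unit diagonal entries, $$L\in\mathcal{L}_{G_\sigma}\iff L^{ -1}\in\mathcal{L}_{G_\sigma}\iff \Sigma:=LDL^T\in P_{G_\sigma}.$$ 3. For every $\Sigma\in P_{G_\sigma}$ with modified Cholesky decomposition $\Sigma=LDL^T$, and for every maximal clique $C$ of $G$, $$\left|(\Sigma^{ -1})_{\sigma(C)}\right|=\prod_{i\in\sigma(C)}\frac{1}{D_{ii}}.$$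
   Context: Graphs are finite, undirected and without loops: $E\subseteq V\times V$ is symmetric, i.e. $(u,v)\in E\iff (v,u)\in E$. All matrices are real. A clique is a set of pairwise adjacent vertices; a maximal clique is a clique not properly contained in another clique. For $v\in V$ write $N[v]=\{u\in V: u=v \text{ or } (u,v)\in E\}$. The graph $G$ is homogeneous if for all $v,v'$ with $(v,v')\in E$, either $N[v']\subseteq N[v]$ or $N[v]\subseteq N[v']$. (Equivalently, $G$ has no induced cycle on 4 or more vertices and no induced path on 4 vertices. $G$ need not be connected.) Write $v\to w$ whenever $N[w]\subseteq N[v]$. Define the equivalence relation $R$ on $V$ by $uRv\iff (u\to v \text{ and } v\to u)$, and let $\bar v$ denote the $R$-class of $v$. If $G$ is homogeneous, an ordering $\sigma$ of $V$ is a Hasse tree based elimination scheme for $G$ if for every pair of vertices $u,v$: $u\to v$ and $\bar u\neq\bar v$ imply $\sigma(u)>\sigma(v)$. $P_{G_\sigma}$ is the set of $p\times p$ symmetric positive definite matrices $\Sigma$ such that $\Sigma_{ij}=0$ whenever $i\ne j$ and $(\sigma^{ -1}(i),\sigma^{ -1}(j))\notin E$. $\mathcal{L}_{G_\sigma}$ is the set of $p\times p$ lower triangular matrices $L$ with $L_{ii}=1$ for all $i$, and $L_{ij}=0$ whenever $i>j$ and $(\sigma^{ -1}(i),\sigma^{ -1}(j))\notin E$. The modified Cholesky decomposition of a positive definite $\Sigma$ is the unique factorization $\Sigma=LDL^T$ with $L$ lower triangular with unit diagonal entries and $D$ diagonal with positive diagonal entries $D_{ii}$. For a $p \times p$ matrix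 $A$ and $M\subseteq\{1,\dots,p\}$, $A_M=(A_{ij})_{i,j\in M}$ is the principal submatrix, and $|A_M|$ is its determinant. $\sigma(C)=\{\sigma(u):u\in C\}$. -}

module Defs where

open import Level using (Level; _⊔_; suc; 0ℓ)
open import Algebra.Apartness.Bundles using (HeytingField)
open import Algebra.Bundles using (CommutativeRing; RawSemiring; Semiring)
import Algebra.Definitions.RawSemiring as RawSemiringDefs
open import Data.Bool.Base using (Bool; true; false; T)
open import Data.Fin.Base as Fin using (Fin; toℕ; punchIn)
open import Data.Fin.Properties using (_≟_)
open import Data.Fin.Subset using (Subset; ∣_∣)
open import Data.Nat.Base as ℕ using (ℕ)
open import Data.Product.Base using (_×_; _,_; ∃-syntax; proj₁)
open import Data.Sum.Base using (_⊎_; inj₂)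
open import Data.Vec.Base as Vec using ([]; _∷_)
open import Data.Vec.Functional using (Vector)
open import Function.Base using (_∘_)
open import Function.Bundles using (_⇔_; _↔_; module Equivalence; module Inverse)
open import Relation.Binary.Core using (Rel)
open import Relation.Binary.Definitions using (Symmetric; Decidable)
open import Relation.Binary.PropositionalEquality.Core using (_≡_; _≢_)
open import Relation.Binary.Structures using (IsStrictPartialOrder)
open import Relation.Nullary.Decidable.Core using (yes; no)
open import Relation.Nullary.Negation.Core using (¬_)
open import Relation.Unary using (Pred; _⊆_; _⊂_)

private variable
  v e : Level
  n p : ℕ

-- The field of real numbers, by its usual characterisation: an Archimedean,
-- Cauchy complete ordered field.  The axioms are phrased with a Heyting field
-- (invertible means apart from 0) and a strict order whose induced apartness is
-- the field's own, so that they hold constructively of the Cauchy reals;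
-- classically they determine ℝ up to unique isomorphism.

record Reals c ℓ₁ ℓ₂ ℓ₃ : Set (suc (c ⊔ ℓ₁ ⊔ ℓ₂ ⊔ ℓ₃)) where
  field
    heytingField : HeytingField c ℓ₁ ℓ₂

  open HeytingField heytingField public

  commutativeRing : CommutativeRing c ℓ₁
  commutativeRing = record { isCommutativeRing = isCommutativeRing }

  rawSemiring : RawSemiring c ℓ₁
  rawSemiring = Semiring.rawSemiring (CommutativeRing.semiring commutativeRing)

  open RawSemiringDefs rawSemiring public
    using (sum; product; _^_) renaming (_×_ to _·_)

  infix 4 _<_
  field
    _<_                  : Rel Carrier ℓ₃
    isStrictPartialOrder : IsStrictPartialOrder _≈_ _<_
    #⇔<⊎>                : ∀ x y → x # y ⇔ (x < y ⊎ y < x)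
    +-monoˡ-<            : ∀ {x y} z → x < y → x + z < y + z
    *-pos                : ∀ {x y} → 0# < x → 0# < y → 0# < x * y
    archimedean          : ∀ x → ∃[ k ] x < k · 1#

  IsCauchy : (ℕ → Carrier) → Set (c ⊔ ℓ₃)
  IsCauchy a = ∀ ε → 0# < ε →
    ∃[ N ] (∀ i j → N ℕ.≤ i → N ℕ.≤ j → a i < a j + ε)

  _ConvergesTo_ : (ℕ → Carrier) → Carrier → Set (c ⊔ ℓ₃)
  a ConvergesTo x = ∀ ε → 0# < ε →
    ∃[ N ] (∀ i → N ℕ.≤ i → a i < x + ε × x < a i + ε)

  field
    complete : ∀ a → IsCauchy a → ∃[ x ] a ConvergesTo x

-- Decidability of adjacency is part of being a finite graph.  Finiteness itself
-- is supplied by an ordering V ↔ Fin p.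

record Graph (V : Set v) (e : Level) : Set (v ⊔ suc e) where
  field
    E        : Rel V e
    E?       : Decidable E
    E-sym    : Symmetric E
    E-irrefl : ∀ {u} → ¬ E u u

  N[_] : V → Pred V (v ⊔ e)
  N[ w ] u = u ≡ w ⊎ E u w

  _⟶_ : Rel V (v ⊔ e)
  u ⟶ w = N[ w ] ⊆ N[ u ]

  _R_ : Rel V (v ⊔ e)
  u R w = u ⟶ w × w ⟶ u

  IsHomogeneous : Set (v ⊔ e)
  IsHomogeneous = ∀ u w → E u w → (N[ w ] ⊆ N[ u ]) ⊎ (N[ u ] ⊆ N[ w ])

  VertexSet : Set v
  VertexSet = V → Bool

  members : VertexSet → Pred V 0ℓ
  members C u = T (C u)

  IsClique : VertexSet → Set (v ⊔ e)
  IsClique C = ∀ u w → members C u → members C w → u ≢ w → E u w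

  IsMaximalClique : VertexSet → Set (v ⊔ e)
  IsMaximalClique C =
    IsClique C × (∀ C′ → IsClique C′ → ¬ (members C ⊂ members C′))

Ordering : Set v → ℕ → Set v
Ordering V p = V ↔ Fin p

module _ {V : Set v} (G : Graph V e) (σ : Ordering V p) where
  open Graph G
  open Inverse σ using () renaming (to to pos; from to vtx)

  -- ū ≠ w̄ for the R-classes means that u and w are not R-related.
  IsHasseTreeScheme : Set (v ⊔ e)
  IsHasseTreeScheme = ∀ u w → u ⟶ w → ¬ (u R w) → pos u Fin.> pos w

  NonEdge : Fin p → Fin p → Set e
  NonEdge i j = ¬ E (vtx i) (vtx j)

  -- σ(C) = { σ(u) : u ∈ C }
  image : VertexSet → Subset p
  image C = Vec.tabulate (C ∘ vtx)

elements : (M : Subset n) → Vector (Fin n) ∣ M ∣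
elements (true  ∷ M) Fin.zero    = Fin.zero
elements (true  ∷ M) (Fin.suc k) = Fin.suc (elements M k)
elements (false ∷ M) k           = Fin.suc (elements M k)

module _ {c ℓ₁ ℓ₂ ℓ₃} (ℝ : Reals c ℓ₁ ℓ₂ ℓ₃) where
  open Reals ℝ

  reciprocal : ∀ {x} → 0# < x → Carrier
  reciprocal {x} 0<x =
    -- #⇒invertible gives an inverse of x - 0#, which is ≈ x
    proj₁ (#⇒invertible (Equivalence.from (#⇔<⊎> x 0#) (inj₂ 0<x)))

  Matrix : ℕ → Set c
  Matrix n = Fin n → Fin n → Carrier

  infix 4 _≋_
  _≋_ : Rel (Matrix n) ℓ₁
  A ≋ B = ∀ i j → A i j ≈ B i j

  infixl 7 _⊗_
  _⊗_ : Matrix n → Matrix n → Matrix n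
  (A ⊗ B) i j = sum (λ k → A i k * B k j)

  infix 8 _ᵀ
  _ᵀ : Matrix n → Matrix n
  (A ᵀ) i j = A j i

  𝟙 : Matrix n
  𝟙 i j with i ≟ j
  ... | yes _ = 1#
  ... | no  _ = 0#

  IsInverse : Matrix n → Matrix n → Set ℓ₁
  IsInverse A B = (A ⊗ B ≋ 𝟙) × (B ⊗ A ≋ 𝟙)

  -- Laplace expansion along the first row.
  det : Matrix n → Carrier
  det {ℕ.zero}  A = 1#
  det {ℕ.suc n} A = sum λ j →
    (- 1#) ^ toℕ j * (A Fin.zero j * det (λ i k → A (Fin.suc i) (punchIn j k)))

  principal : Matrix n → (M : Subset n) → Matrix ∣ M ∣
  principal A M i j = A (elements M i) (elements M j)

  IsPositiveDiagonal : Matrix n → Set (ℓ₁ ⊔ ℓ₃)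
  IsPositiveDiagonal D =
    (∀ i j → i ≢ j → D i j ≈ 0#) × (∀ i → 0# < D i i)

  IsUnitLowerTriangular : Matrix n → Set ℓ₁
  IsUnitLowerTriangular L =
    (∀ i j → i Fin.< j → L i j ≈ 0#) × (∀ i → L i i ≈ 1#)

  -- A vector is nonzero when some entry is apart from 0.
  IsPositiveDefinite : Matrix n → Set (c ⊔ ℓ₂ ⊔ ℓ₃)
  IsPositiveDefinite {n} A = ∀ (x : Vector Carrier n) → (∃[ i ] x i # 0#) →
    0# < sum (λ i → sum (λ j → x i * A i j * x j))

  IsModifiedCholesky : Matrix n → Matrix n → Matrix n → Set (ℓ₁ ⊔ ℓ₃)
  IsModifiedCholesky S L D =
    IsUnitLowerTriangular L × IsPositiveDiagonal D × (S ≋ L ⊗ D ⊗ L ᵀ)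

  module _ {V : Set v} (G : Graph V e) (σ : Ordering V p) where
    open Graph G

    𝓟 : Pred (Matrix p) (c ⊔ ℓ₁ ⊔ ℓ₂ ⊔ ℓ₃ ⊔ e)
    𝓟 S = (S ≋ S ᵀ) × IsPositiveDefinite S ×
          (∀ i j → i ≢ j → NonEdge G σ i j → S i j ≈ 0#)

    𝓛 : Pred (Matrix p) (ℓ₁ ⊔ e)
    𝓛 L = IsUnitLowerTriangular L ×
          (∀ i j → i Fin.> j → NonEdge G σ i j → L i j ≈ 0#)

    -- Inverses are unique, and are introduced through the equations that
    -- define them.
    ZerosPreserved : Set (c ⊔ ℓ₁ ⊔ ℓ₂ ⊔ ℓ₃ ⊔ e)
    ZerosPreserved =
      ∀ (D L L⁻¹ : Matrix p) →
      IsPositiveDiagonal D → IsUnitLowerTriangular L → IsInverse L L⁻¹ →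
      (𝓛 L ⇔ 𝓛 L⁻¹) × (𝓛 L⁻¹ ⇔ 𝓟 (L ⊗ D ⊗ L ᵀ))

    CliqueDeterminants : Set (v ⊔ c ⊔ ℓ₁ ⊔ ℓ₂ ⊔ ℓ₃ ⊔ e)
    CliqueDeterminants =
      ∀ (S S⁻¹ L D : Matrix p) →
      𝓟 S → IsInverse S S⁻¹ → ((_ , (_ , D>0) , _) : IsModifiedCholesky S L D) →
      ∀ (C : VertexSet) → IsMaximalClique C →
      det (principal S⁻¹ (image G σ C)) ≈
      product (λ k → reciprocal (D>0 (elements (image G σ C) k)))

{-# OPTIONS --safe #-}
module Submission where

-- On positions, condition 1 says that N[j] ⊆ N[i] whenever j < i are adjacent.
-- This splits into transitivity of the pattern of lower triangular matrices
-- (k < j < i), which makes 𝓛 closed under inverses, and absence of fill-in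
-- (j < i, k), which makes the zeros of L and of LDLᵀ agree.  It also makes
-- maximal cliques closed under passing to later neighbours, so that
-- (Σ⁻¹)_C = (M_C)ᵀ (D_C)⁻¹ M_C for M = L⁻¹.
-- Conversely, a path i − j − k with j < i and no edge i − k yields a
-- counterexample to either of the other conditions with D = 1 and L differing
-- from the identity in two rows.

open import Defs
open import Algebra.Bundles using (CommutativeMonoid; CommutativeRing; Monoid)
import Algebra.Apartness.Properties.HeytingCommutativeRing as HeytingProperties
import Algebra.Properties.CommutativeMonoid.Sum as MonoidSum
import Algebra.Properties.Ring as RingProperties
import Algebra.Properties.Semiring.Sum as SemiringSum
import Algebra.Solver.Ring.NaturalCoefficients.Default as SemiringSolver
open import Data.Bool.Base using (true; false; _∨_)
open import Data.Bool.Properties using (T-∨; T-≡; T?)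
open import Data.Empty using (⊥; ⊥-elim)
open import Data.Fin.Base as Fin using (Fin; zero; suc; toℕ; punchIn; punchOut; inject₁)
import Data.Fin.Induction as Fin
import Data.Fin.Properties as Fin
open import Data.Fin.Subset using (Subset; ∣_∣)
open import Data.List.Base as List using (List; []; _∷_)
open import Data.List.Membership.Propositional using (_∈_)
open import Data.List.Membership.Propositional.Properties using (∈-allFin; ∈-map⁺)
open import Data.List.Relation.Unary.Any using (here; there)
open import Data.Nat.Base as ℕ using (ℕ; zero; suc; z≤n; s≤s)
import Data.Nat.Properties as ℕ
open import Data.Product.Base using (_×_; _,_; Σ-syntax; ∃-syntax; proj₁; proj₂)
open import Data.Sum.Base using (_⊎_; inj₁; inj₂; [_,_]′)
open import Data.Vec.Base using ([]; _∷_; lookup)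
open import Data.Vec.Functional as Vector using (Vector; updateAt; tail)
import Data.Vec.Functional.Properties as Vector
open import Data.Vec.Properties using (lookup∘tabulate)
open import Function.Base using (_∘_; const; id)
open import Function.Bundles using (_⇔_; mk⇔; module Equivalence; module Inverse)
open import Induction.WellFounded using (Acc; acc)
open import Relation.Binary.Core using (Rel)
open import Relation.Binary.Definitions
  using (Decidable; DecidableEquality; Reflexive; Transitive; tri<; tri≈; tri>)
open import Relation.Binary.PropositionalEquality.Core as ≡ using (_≡_; _≢_)
import Relation.Binary.Reasoning.Setoid as ≈-Reasoning
open import Relation.Binary.Structures using (IsStrictPartialOrder)
open import Relation.Nullary.Decidable
  using (Dec; yes; no; isYes; toWitness; fromWitness; map′; ¬?; _→-dec_; _×-dec_; _⊎-dec_)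
open import Relation.Nullary.Negation.Core using (¬_; contradiction)
open import Relation.Unary using (_⊆_)

-- The order on the reals is not decidable, so nonnegativity is rendered as `¬ x < 0#`, a nonzero
-- vector as one with an entry apart from 0, and no argument may split on whether a real number
-- vanishes. Determinants are given by Laplace expansion, and their multiplicativity is avoided: the
-- only ones ever evaluated are those of UᵀEU with U unit lower triangular and E diagonal, where
-- column operations suffice. The counterexamples are built from rows e_i + e_j. Such a row of L
-- turns LM = 1 into the relation M_i + M_j = e_i between rows of the inverse, so the needed entries
-- of M can be read off without computing M. Against condition 2 the offending entry at (i, k) is
-- exhibited directly. Against condition 3 the matrix LLᵀ must itself lie in 𝓟, so any fill-in has
-- to be repaired, and the contradiction appears in a determinant instead. Either way it takes the
-- form 1 ≈ 0.

private variable
  n : ℕ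

-- Determinants

-- Deleting a column other than `c` and `c + 1` leaves these two adjacent, so a minor inherits a
-- pair of equal adjacent columns.
punchIn-adjacent : (c : Fin (suc n)) (j : Fin (2 ℕ.+ n)) → j ≢ inject₁ c → j ≢ suc c →
  ∃[ c′ ] punchIn j (inject₁ c′) ≡ inject₁ c × punchIn j (suc c′) ≡ suc c
punchIn-adjacent zero zero j≢ _ = contradiction ≡.refl j≢
punchIn-adjacent zero (suc zero) _ j≢ = contradiction ≡.refl j≢
punchIn-adjacent {suc _} zero (suc (suc j)) _ _ = zero , ≡.refl , ≡.refl
punchIn-adjacent {suc _} (suc c) zero _ _ = c , ≡.refl , ≡.refl
punchIn-adjacent {suc _} (suc c) (suc j) j≢ j≢′ =
  let c′ , eq , eq′ = punchIn-adjacent c j (j≢ ∘ ≡.cong suc) (j≢′ ∘ ≡.cong suc)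
  in suc c′ , ≡.cong suc eq , ≡.cong suc eq′

-- The minors omitting column `c` and column `c + 1` differ only in the one place where the first
-- retains `c + 1` and the second `c`. Equal columns therefore give equal minors.
punchIn-inject₁-suc : (c : Fin n) (k : Fin n) →
  punchIn (inject₁ c) k ≡ punchIn (suc c) k
  ⊎ (punchIn (inject₁ c) k ≡ suc c × punchIn (suc c) k ≡ inject₁ c)
punchIn-inject₁-suc zero zero = inj₂ (≡.refl , ≡.refl)
punchIn-inject₁-suc zero (suc k) = inj₁ ≡.refl
punchIn-inject₁-suc (suc c) zero = inj₁ ≡.refl
punchIn-inject₁-suc (suc c) (suc k) with punchIn-inject₁-suc c k
... | inj₁ eq = inj₁ (≡.cong suc eq)
... | inj₂ (eq , eq′) = inj₂ (≡.cong suc eq , ≡.cong suc eq′)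

inject₁≢suc : (c : Fin n) → inject₁ c ≢ suc c
inject₁≢suc (suc c) eq = inject₁≢suc c (Fin.suc-injective eq)

-- Stated over a commutative monoid in order to serve both `sum` and `product`.
module FiniteSums {c ℓ} (M : CommutativeMonoid c ℓ) where

  open CommutativeMonoid M renaming
    (_∙_ to _+_; ε to 0#; ∙-cong to +-cong; ∙-congˡ to +-congˡ; identityʳ to +-identityʳ)
  open MonoidSum M using (sum; sum-remove)

  sum-zero : {t : Vector Carrier n} → (∀ i → t i ≈ 0#) → sum t ≈ 0#
  sum-zero {zero} t≈0 = refl
  sum-zero {suc n} t≈0 = trans (+-cong (t≈0 zero) (sum-zero (t≈0 ∘ suc))) (+-identityʳ 0#)

  sum-single : (i : Fin n) {t : Vector Carrier n} → (∀ j → j ≢ i → t j ≈ 0#) → sum t ≈ t i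
  sum-single {suc n} i {t} t≈0 = trans (sum-remove {i = i} t)
    (trans (+-congˡ (sum-zero λ j → t≈0 _ (Fin.punchInᵢ≢i i j))) (+-identityʳ _))

module Determinants {r ℓ₁ ℓ₂ ℓ₃} (ℝ : Reals r ℓ₁ ℓ₂ ℓ₃) where

  open Reals ℝ hiding (zero)
  open CommutativeRing commutativeRing public
    using (semiring; commutativeSemiring; ring; +-commutativeMonoid; *-commutativeMonoid)
  open SemiringSum semiring public
    using (sum-cong-≋; ∑-distrib-+; ∑-comm; *-distribˡ-sum; *-distribʳ-sum)
  open FiniteSums +-commutativeMonoid public
  open FiniteSums *-commutativeMonoid public
    using () renaming (sum-zero to product-one; sum-single to product-single)
  open RingProperties ring public
  open SemiringSolver commutativeSemiring public using (solve; _:+_; _:*_; _:=_; con)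
  open ≈-Reasoning setoid

  sum-linear : ∀ s (f g : Vector Carrier n) → sum (λ i → f i + s * g i) ≈ sum f + s * sum g
  sum-linear s f g = trans (∑-distrib-+ f _) (+-congˡ (sym (*-distribˡ-sum s g)))

  sum-adjacent : (c : Fin n) {t : Vector Carrier (suc n)} → t (inject₁ c) + t (suc c) ≈ 0# →
    (∀ j → j ≢ inject₁ c → j ≢ suc c → t j ≈ 0#) → sum t ≈ 0#
  sum-adjacent zero {t} t+t≈0 t≈0 = begin
    t zero + (t (suc zero) + sum (tail (tail t)))
      ≈⟨ +-assoc _ _ _ ⟨
    t zero + t (suc zero) + sum (tail (tail t))
      ≈⟨ +-cong t+t≈0 (sum-zero λ j → t≈0 (suc (suc j)) (λ ()) (λ ())) ⟩
    0# + 0#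
      ≈⟨ +-identityʳ 0# ⟩
    0# ∎
  sum-adjacent (suc c) t+t≈0 t≈0 =
    trans (+-cong (t≈0 zero (λ ()) (λ ()))
            (sum-adjacent c t+t≈0
              λ j j≢ j≢′ → t≈0 (suc j) (j≢ ∘ Fin.suc-injective) (j≢′ ∘ Fin.suc-injective)))
      (+-identityʳ 0#)

  minor : Matrix ℝ (suc n) → Fin (suc n) → Matrix ℝ n
  minor A j i k = A (suc i) (punchIn j k)

  det-cong : {A B : Matrix ℝ n} → (∀ i j → A i j ≈ B i j) → det ℝ A ≈ det ℝ B
  det-cong {zero} A≈B = refl
  det-cong {suc n} A≈B = sum-cong-≋ λ j →
    *-congˡ {x = (- 1#) ^ toℕ j} (*-cong (A≈B zero j) (det-cong λ i k → A≈B (suc i) (punchIn j k)))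

  _AgreesOff_With_ : Matrix ℝ n → Fin n → Matrix ℝ n → Set ℓ₁
  A AgreesOff c With B = ∀ i j → j ≢ c → A i j ≈ B i j

  -- In the expansion along the first row, column `c` enters the term `j = c` through the entry
  -- alone, and every other term through the minor alone, where its index is `punchOut`.
  det-linear : (c : Fin n) (s : Carrier) {A B C : Matrix ℝ n} →
    A AgreesOff c With B → A AgreesOff c With C →
    (∀ i → A i c ≈ B i c + s * C i c) → det ℝ A ≈ det ℝ B + s * det ℝ C
  det-linear {suc n} c s {A} {B} {C} A≈B A≈C A≈B+sC =
    trans (sum-cong-≋ term)
      (sum-linear s (λ j → sign j * (B zero j * det ℝ (minor B j)))
        (λ j → sign j * (C zero j * det ℝ (minor C j))))
    where
    sign : Fin (suc n) → Carrier
    sign j = (- 1#) ^ toℕ j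

    term : ∀ j → sign j * (A zero j * det ℝ (minor A j)) ≈
      sign j * (B zero j * det ℝ (minor B j)) + s * (sign j * (C zero j * det ℝ (minor C j)))
    term j with j Fin.≟ c
    ... | yes ≡.refl = begin
      sign j * (A zero j * det ℝ (minor A j))
        ≈⟨ *-congˡ (*-congʳ (A≈B+sC zero)) ⟩
      sign j * ((B zero j + s * C zero j) * det ℝ (minor A j))
        ≈⟨ solve 5 (λ e b s c d → e :* ((b :+ s :* c) :* d) := e :* (b :* d) :+ s :* (e :* (c :* d)))
             refl (sign j) (B zero j) s (C zero j) _ ⟩
      sign j * (B zero j * det ℝ (minor A j)) + s * (sign j * (C zero j * det ℝ (minor A j)))
        ≈⟨ +-cong (*-congˡ (*-congˡ (det-cong λ i k → A≈B _ _ (Fin.punchInᵢ≢i j k))))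
             (*-congˡ (*-congˡ (*-congˡ (det-cong λ i k → A≈C _ _ (Fin.punchInᵢ≢i j k))))) ⟩
      _ ∎
    ... | no j≢c = begin
      sign j * (A zero j * det ℝ (minor A j))
        ≈⟨ *-congˡ (*-congˡ (det-linear c′ s
             (λ i k k≢ → A≈B _ _ (off k≢)) (λ i k k≢ → A≈C _ _ (off k≢)) at)) ⟩
      sign j * (A zero j * (det ℝ (minor B j) + s * det ℝ (minor C j)))
        ≈⟨ solve 5 (λ e a b s c → e :* (a :* (b :+ s :* c)) := e :* (a :* b) :+ s :* (e :* (a :* c)))
             refl (sign j) (A zero j) _ s _ ⟩
      sign j * (A zero j * det ℝ (minor B j)) + s * (sign j * (A zero j * det ℝ (minor C j)))
        ≈⟨ +-cong (*-congˡ (*-congʳ (A≈B _ _ j≢c))) (*-congˡ (*-congˡ (*-congʳ (A≈C _ _ j≢c)))) ⟩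
      _ ∎
      where
      c′ = punchOut j≢c
      off : ∀ {k} → k ≢ c′ → punchIn j k ≢ c
      off k≢c′ eq = k≢c′ (Fin.punchIn-injective j _ _ (≡.trans eq (≡.sym (Fin.punchIn-punchOut j≢c))))
      at : ∀ i → minor A j i c′ ≈ minor B j i c′ + s * minor C j i c′
      at i rewrite Fin.punchIn-punchOut j≢c = A≈B+sC (suc i)

  -- The terms of the two equal columns have the same entry and the same minor but opposite signs.
  -- Every other minor still contains both columns and vanishes by induction.
  det-equal-adjacent : (c : Fin n) {A : Matrix ℝ (suc n)} →
    (∀ i → A i (inject₁ c) ≈ A i (suc c)) → det ℝ A ≈ 0#
  det-equal-adjacent {suc n} c {A} eq = sum-adjacent c cancel vanish
    where
    minors : ∀ i k → minor A (inject₁ c) i k ≈ minor A (suc c) i k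
    minors i k with punchIn-inject₁-suc c k
    ... | inj₁ p = reflexive (≡.cong (A (suc i)) p)
    ... | inj₂ (p , q) = trans (reflexive (≡.cong (A (suc i)) p))
      (trans (sym (eq (suc i))) (reflexive (≡.cong (A (suc i)) (≡.sym q))))

    x = A zero (suc c) * det ℝ (minor A (suc c))

    cancel : (- 1#) ^ toℕ (inject₁ c) * (A zero (inject₁ c) * det ℝ (minor A (inject₁ c)))
      + (- 1#) ^ toℕ (suc c) * x ≈ 0#
    cancel = begin
      (- 1#) ^ toℕ (inject₁ c) * (A zero (inject₁ c) * det ℝ (minor A (inject₁ c)))
        + - 1# * (- 1#) ^ toℕ c * x
        ≈⟨ +-cong (*-cong (reflexive (≡.cong ((- 1#) ^_) (Fin.toℕ-inject₁ c)))
             (*-cong (eq zero) (det-cong minors))) (*-congʳ (-1*x≈-x _)) ⟩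
      (- 1#) ^ toℕ c * x + - ((- 1#) ^ toℕ c) * x
        ≈⟨ distribʳ x _ _ ⟨
      ((- 1#) ^ toℕ c - (- 1#) ^ toℕ c) * x
        ≈⟨ *-congʳ (-‿inverseʳ _) ⟩
      0# * x
        ≈⟨ zeroˡ x ⟩
      0# ∎

    vanish : ∀ j → j ≢ inject₁ c → j ≢ suc c →
      (- 1#) ^ toℕ j * (A zero j * det ℝ (minor A j)) ≈ 0#
    vanish j j≢ j≢′ with c′ , p , q ← punchIn-adjacent c j j≢ j≢′ =
      trans (*-congˡ (trans (*-congˡ (det-equal-adjacent c′ {minor A j} λ i →
        trans (reflexive (≡.cong (A (suc i)) p))
          (trans (eq (suc i)) (reflexive (≡.cong (A (suc i)) (≡.sym q))))))
        (zeroʳ _))) (zeroʳ _)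

  -- Expand the determinant, which is 0, of the matrix having the sum of the
  -- two columns in both places.
  det-swap-adjacent : (c : Fin n) {A B : Matrix ℝ (suc n)} →
    (∀ i → B i (inject₁ c) ≈ A i (suc c)) → (∀ i → B i (suc c) ≈ A i (inject₁ c)) →
    (∀ i j → j ≢ inject₁ c → j ≢ suc c → B i j ≈ A i j) → det ℝ A + det ℝ B ≈ 0#
  det-swap-adjacent {n} c {A} {B} B≈A B≈A′ off = begin
    det ℝ A + det ℝ B
      ≈⟨ +-cong (det-cong A≈) (det-cong B≈) ⟩
    d u v + d v u
      ≈⟨ solve 2 (λ x y → x :+ y := (con 0 :+ con 1 :* x) :+ con 1 :* (y :+ con 1 :* con 0)) refl _ _ ⟩
    (0# + 1# * d u v) + 1# * (d v u + 1# * 0#)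
      ≈⟨ +-cong (+-congʳ (equal u)) (*-congˡ (+-congˡ (*-congˡ (equal v)))) ⟨
    (d u u + 1# * d u v) + 1# * (d v u + 1# * d v v)
      ≈⟨ +-cong (linear₂ u u v) (*-congˡ (linear₂ v u v)) ⟨
    d u (u ⊕ v) + 1# * d v (u ⊕ v)
      ≈⟨ linear₁ u v (u ⊕ v) ⟨
    d (u ⊕ v) (u ⊕ v)
      ≈⟨ equal (u ⊕ v) ⟩
    0# ∎
    where
    a b : Fin (suc n)
    a = inject₁ c
    b = suc c
    a≢b = inject₁≢suc c

    u v : Vector Carrier (suc n)
    u i = A i a
    v i = A i b

    _⊕_ : Vector Carrier (suc n) → Vector Carrier (suc n) → Vector Carrier (suc n)
    (x ⊕ y) i = x i + 1# * y i

    X : (x y : Vector Carrier (suc n)) → Matrix ℝ (suc n)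
    X x y i = updateAt (updateAt (A i) a (const (x i))) b (const (y i))

    X-a : ∀ x y i → X x y i a ≡ x i
    X-a x y i = ≡.trans (Vector.updateAt-minimal a b (updateAt (A i) a (const (x i))) a≢b)
      (Vector.updateAt-updates a (A i))
    X-b : ∀ x y i → X x y i b ≡ y i
    X-b x y i = Vector.updateAt-updates b (updateAt (A i) a (const (x i)))
    X-off : ∀ x y i {j} → j ≢ a → j ≢ b → X x y i j ≡ A i j
    X-off x y i j≢a j≢b = ≡.trans (Vector.updateAt-minimal _ b (updateAt (A i) a (const (x i))) j≢b)
      (Vector.updateAt-minimal _ a (A i) j≢a)

    X-agree₁ : ∀ x x′ y → X x y AgreesOff a With X x′ y
    X-agree₁ x x′ y i j j≢a with j Fin.≟ b
    ... | yes ≡.refl = reflexive (≡.trans (X-b x y i) (≡.sym (X-b x′ y i)))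
    ... | no j≢b = reflexive (≡.trans (X-off x y i j≢a j≢b) (≡.sym (X-off x′ y i j≢a j≢b)))

    X-agree₂ : ∀ x y y′ → X x y AgreesOff b With X x y′
    X-agree₂ x y y′ i j j≢b with j Fin.≟ a
    ... | yes ≡.refl = reflexive (≡.trans (X-a x y i) (≡.sym (X-a x y′ i)))
    ... | no j≢a = reflexive (≡.trans (X-off x y i j≢a j≢b) (≡.sym (X-off x y′ i j≢a j≢b)))

    X-unique : ∀ {x y} {Z : Matrix ℝ (suc n)} → (∀ i → Z i a ≈ x i) → (∀ i → Z i b ≈ y i) →
      (∀ i j → j ≢ a → j ≢ b → Z i j ≈ A i j) → ∀ i j → Z i j ≈ X x y i j
    X-unique {x} {y} Za Zb Zoff i j with j Fin.≟ a | j Fin.≟ b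
    ... | yes ≡.refl | _ = trans (Za i) (reflexive (≡.sym (X-a x y i)))
    ... | no _ | yes ≡.refl = trans (Zb i) (reflexive (≡.sym (X-b x y i)))
    ... | no j≢a | no j≢b = trans (Zoff i j j≢a j≢b) (reflexive (≡.sym (X-off x y i j≢a j≢b)))

    A≈ : ∀ i j → A i j ≈ X u v i j
    A≈ = X-unique (λ _ → refl) (λ _ → refl) (λ _ _ _ _ → refl)
    B≈ : ∀ i j → B i j ≈ X v u i j
    B≈ = X-unique B≈A B≈A′ off

    d : (x y : Vector Carrier (suc n)) → Carrier
    d x y = det ℝ (X x y)

    equal : ∀ x → d x x ≈ 0#
    equal x = det-equal-adjacent c {X x x} λ i → reflexive (≡.trans (X-a x x i) (≡.sym (X-b x x i)))

    linear₁ : ∀ x x′ y → d (x ⊕ x′) y ≈ d x y + 1# * d x′ y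
    linear₁ x x′ y = det-linear a 1# {X (x ⊕ x′) y} {X x y} {X x′ y} (X-agree₁ _ _ y) (X-agree₁ _ _ y) λ i →
      reflexive (≡.trans (X-a (x ⊕ x′) y i)
        (≡.cong₂ (λ z z′ → z + 1# * z′) (≡.sym (X-a x y i)) (≡.sym (X-a x′ y i))))

    linear₂ : ∀ x y y′ → d x (y ⊕ y′) ≈ d x y + 1# * d x y′
    linear₂ x y y′ = det-linear b 1# {X x (y ⊕ y′)} {X x y} {X x y′} (X-agree₂ x _ _) (X-agree₂ x _ _) λ i →
      reflexive (≡.trans (X-b x (y ⊕ y′) i)
        (≡.cong₂ (λ z z′ → z + 1# * z′) (≡.sym (X-b x y i)) (≡.sym (X-b x y′ i))))

  -- An adjacent swap only changes the sign and brings the copy of the first column one place closer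
  -- to it, until the two are adjacent.
  det-equal-first : (j : Fin n) {A : Matrix ℝ (suc n)} →
    (∀ i → A i zero ≈ A i (suc j)) → det ℝ A ≈ 0#
  det-equal-first {suc n} = Fin.<-weakInduction P (λ {A} → det-equal-adjacent zero {A}) step
    where
    P : Fin (suc n) → Set _
    P j = {A : Matrix ℝ (2 ℕ.+ n)} → (∀ i → A i zero ≈ A i (suc j)) → det ℝ A ≈ 0#

    step : ∀ j → P (inject₁ j) → P (suc j)
    step j ih {A} eq = begin
      det ℝ A            ≈⟨ +-identityʳ _ ⟨
      det ℝ A + 0#       ≈⟨ +-congˡ (ih {B} λ i → trans (eq i) (reflexive (≡.sym (B-a i)))) ⟨
      det ℝ A + det ℝ B  ≈⟨ det-swap-adjacent (suc j) {A} {B} (λ i → reflexive (B-a i)) (λ i → reflexive (B-b i))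
                              (λ i k p q → reflexive (B-off i p q)) ⟩
      0#                 ∎
      where
      a b : Fin (2 ℕ.+ n)
      a = inject₁ (suc j)
      b = suc (suc j)
      B : Matrix ℝ (2 ℕ.+ n)
      B i = updateAt (updateAt (A i) a (const (A i b))) b (const (A i a))
      B-a : ∀ i → B i a ≡ A i b
      B-a i = ≡.trans (Vector.updateAt-minimal a b (updateAt (A i) a (const (A i b))) (inject₁≢suc (suc j)))
        (Vector.updateAt-updates a (A i))
      B-b : ∀ i → B i b ≡ A i a
      B-b i = Vector.updateAt-updates b (updateAt (A i) a (const (A i b)))
      B-off : ∀ i {k} → k ≢ a → k ≢ b → B i k ≡ A i k
      B-off i p q = ≡.trans (Vector.updateAt-minimal _ b (updateAt (A i) a (const (A i b))) q)
        (Vector.updateAt-minimal _ a (A i) p)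

  replaceFirst : Vector Carrier (suc n) → Matrix ℝ (suc n) → Matrix ℝ (suc n)
  replaceFirst x A i = x i Vector.∷ tail (A i)

  -- The number `m` of summands is kept apart from the size of the matrix, so that the induction
  -- removes summands while the matrix stays fixed.
  det-replaceFirst-sum : ∀ {m} (A : Matrix ℝ (suc n)) (b : Vector Carrier (suc n))
    (w : Vector Carrier m) (x : Fin m → Vector Carrier (suc n)) →
    (∀ l → det ℝ (replaceFirst (x l) A) ≈ 0#) →
    det ℝ (replaceFirst (λ i → b i + sum (λ l → w l * x l i)) A) ≈ det ℝ (replaceFirst b A)
  det-replaceFirst-sum {m = zero} A b w x _ =
    det-cong {A = replaceFirst (λ i → b i + 0#) A} {replaceFirst b A} λ where
      i zero → +-identityʳ _
      i (suc j) → refl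
  det-replaceFirst-sum {m = suc m} A b w x x≈0 = begin
    det ℝ (replaceFirst (λ i → b i + sum (λ l → w l * x l i)) A)
      ≈⟨ det-linear zero (w zero)
           {replaceFirst (λ i → b i + sum (λ l → w l * x l i)) A}
           {replaceFirst (λ i → b i + sum (λ l → w (suc l) * x (suc l) i)) A}
           {replaceFirst (x zero) A}
           (λ { i zero 0≢0 → contradiction ≡.refl 0≢0; i (suc j) _ → refl })
           (λ { i zero 0≢0 → contradiction ≡.refl 0≢0; i (suc j) _ → refl })
           (λ i → solve 3 (λ b y s → b :+ (y :+ s) := (b :+ s) :+ y) refl
             (b i) (w zero * x zero i) (sum (λ l → w (suc l) * x (suc l) i))) ⟩
    det ℝ (replaceFirst (λ i → b i + sum (λ l → w (suc l) * x (suc l) i)) A)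
      + w zero * det ℝ (replaceFirst (x zero) A)
      ≈⟨ +-cong (det-replaceFirst-sum A b (w ∘ suc) (x ∘ suc) (x≈0 ∘ suc)) (*-congˡ (x≈0 zero)) ⟩
    det ℝ (replaceFirst b A) + w zero * 0#
      ≈⟨ trans (+-congˡ (zeroʳ _)) (+-identityʳ _) ⟩
    det ℝ (replaceFirst b A) ∎

  det-column-combination : (A : Matrix ℝ (suc n)) (b : Vector Carrier (suc n)) (w : Vector Carrier n) →
    (∀ i → A i zero ≈ b i + sum (λ j → w j * A i (suc j))) →
    det ℝ A ≈ det ℝ (replaceFirst b A)
  det-column-combination A b w eq = trans
    (det-cong {A = A} {replaceFirst (λ i → b i + sum (λ j → w j * A i (suc j))) A}
      λ { i zero → eq i; i (suc j) → refl })
    (det-replaceFirst-sum A b w (λ j i → A i (suc j)) λ j →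
      det-equal-first j {replaceFirst (λ i → A i (suc j)) A} λ _ → refl)

  -- A zero column is the sum of itself with itself, so linearity makes the determinant equal to its
  -- own double.
  det-zero-first-column : {A : Matrix ℝ (suc n)} → (∀ i → A i zero ≈ 0#) → det ℝ A ≈ 0#
  det-zero-first-column {A = A} A≈0 = +-identityˡ-unique _ _ (begin
    det ℝ A + det ℝ A       ≈⟨ +-congˡ (*-identityˡ _) ⟨
    det ℝ A + 1# * det ℝ A  ≈⟨ det-linear zero 1# {A} {A} {A} (λ _ _ _ → refl) (λ _ _ _ → refl) (λ i → begin
        A i zero                  ≈⟨ A≈0 i ⟩
        0#                        ≈⟨ trans (+-congˡ (*-identityˡ 0#)) (+-identityʳ 0#) ⟨
        0# + 1# * 0#              ≈⟨ +-cong (A≈0 i) (*-congˡ (A≈0 i)) ⟨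
        A i zero + 1# * A i zero  ∎) ⟨
    det ℝ A                 ∎)

  -- Although the expansion runs along the first row, it collapses: all minors but the first retain
  -- the first column, which is zero below the top entry.
  det-upper-block : {A : Matrix ℝ (suc n)} → (∀ i → A (suc i) zero ≈ 0#) →
    det ℝ A ≈ A zero zero * det ℝ (λ i j → A (suc i) (suc j))
  det-upper-block {n} {A} A≈0 = begin
    1# * (A zero zero * det ℝ (λ i j → A (suc i) (suc j))) + _
      ≈⟨ +-cong (*-identityˡ _) (sum-zero vanish) ⟩
    A zero zero * det ℝ (λ i j → A (suc i) (suc j)) + 0#
      ≈⟨ +-identityʳ _ ⟩
    A zero zero * det ℝ (λ i j → A (suc i) (suc j)) ∎
    where
    minor≈0 : ∀ (j : Fin n) → det ℝ (minor A (suc j)) ≈ 0#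
    -- The split on `j` only exposes that `n` is a successor, without which the minor has no first
    -- column.
    minor≈0 j@zero = det-zero-first-column {A = minor A (suc j)} A≈0
    minor≈0 j@(suc _) = det-zero-first-column {A = minor A (suc j)} A≈0

    vanish : ∀ (j : Fin n) →
      (- 1#) ^ toℕ (suc j) * (A zero (suc j) * det ℝ (minor A (suc j))) ≈ 0#
    vanish j = trans (*-congˡ (trans (*-congˡ (minor≈0 j)) (zeroʳ _))) (zeroʳ _)

  -- The unit diagonal makes division unnecessary. Besides providing the column operations for
  -- `det-congruence`, this yields the columns of an inverse.
  forward-substitution : {U : Matrix ℝ n} → IsUnitLowerTriangular ℝ U → (u : Vector Carrier n) →
    Σ[ w ∈ Vector Carrier n ] ∀ k → sum (λ j → U k j * w j) ≈ u k
  forward-substitution {zero} _ u = u , λ ()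
  forward-substitution {suc n} {U} (lower , unit) u = w , eq
    where
    rest : Σ[ w ∈ Vector Carrier n ] ∀ k →
      sum (λ j → U (suc k) (suc j) * w j) ≈ u (suc k) - U (suc k) zero * u zero
    rest = forward-substitution {U = λ i j → U (suc i) (suc j)}
      ((λ i j i<j → lower _ _ (s≤s i<j)) , unit ∘ suc) (λ k → u (suc k) - U (suc k) zero * u zero)

    w : Vector Carrier (suc n)
    w = u zero Vector.∷ proj₁ rest

    eq : ∀ k → sum (λ j → U k j * w j) ≈ u k
    eq zero = begin
      U zero zero * u zero + _
        ≈⟨ +-cong (trans (*-congʳ (unit zero)) (*-identityˡ _))
             (sum-zero λ j → trans (*-congʳ (lower zero (suc j) (s≤s z≤n))) (zeroˡ _)) ⟩
      u zero + 0#  ≈⟨ +-identityʳ _ ⟩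
      u zero       ∎
    eq (suc k) = begin
      x + _                 ≈⟨ +-congˡ (proj₂ rest k) ⟩
      x + (u (suc k) - x)   ≈⟨ solve 3 (λ x u y → x :+ (u :+ y) := u :+ (x :+ y)) refl x (u (suc k)) (- x) ⟩
      u (suc k) + (x - x)   ≈⟨ +-congˡ (-‿inverseʳ x) ⟩
      u (suc k) + 0#        ≈⟨ +-identityʳ _ ⟩
      u (suc k)             ∎
      where x = U (suc k) zero * u zero

  -- For U = [1 0; u U′], the first column of UᵀEU is E₀e₀ plus the combination
  -- of the other columns whose coefficients w solve U′w = u.
  det-congruence : {U A : Matrix ℝ n} (E : Vector Carrier n) → IsUnitLowerTriangular ℝ U →
    (∀ i j → A i j ≈ sum (λ k → E k * (U k i * U k j))) → det ℝ A ≈ product E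
  det-congruence {zero} E _ _ = refl
  det-congruence {suc n} {U} {A} E (lower , unit) A≈ = begin
    det ℝ A
      ≈⟨ det-column-combination A b w column ⟩
    det ℝ (replaceFirst b A)
      ≈⟨ det-upper-block {A = replaceFirst b A} (λ i →
           trans (*-congˡ {x = E zero} (lower zero (suc i) (s≤s z≤n))) (zeroʳ _)) ⟩
    E zero * U zero zero * det ℝ (λ i j → A (suc i) (suc j))
      ≈⟨ *-cong (trans (*-congˡ (unit zero)) (*-identityʳ _))
           (det-congruence (E ∘ suc) lower-unit′ A′≈) ⟩
    E zero * product (E ∘ suc) ∎
    where
    U′ : Matrix ℝ n
    U′ i j = U (suc i) (suc j)

    lower-unit′ : IsUnitLowerTriangular ℝ U′
    lower-unit′ = (λ i j i<j → lower _ _ (s≤s i<j)) , unit ∘ suc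

    tail-entry : ∀ i j → A i (suc j) ≈ sum (λ k → E (suc k) * (U (suc k) i * U′ k j))
    tail-entry i j = begin
      A i (suc j)
        ≈⟨ A≈ i (suc j) ⟩
      E zero * (U zero i * U zero (suc j)) + sum (λ k → E (suc k) * (U (suc k) i * U′ k j))
        ≈⟨ +-congʳ (*-congˡ (trans (*-congˡ (lower zero (suc j) (s≤s z≤n))) (zeroʳ _))) ⟩
      E zero * 0# + sum (λ k → E (suc k) * (U (suc k) i * U′ k j))
        ≈⟨ trans (+-congʳ (zeroʳ _)) (+-identityˡ _) ⟩
      sum (λ k → E (suc k) * (U (suc k) i * U′ k j)) ∎

    A′≈ : ∀ i j → A (suc i) (suc j) ≈ sum (λ k → E (suc k) * (U′ k i * U′ k j))
    A′≈ i j = tail-entry (suc i) j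

    solution : Σ[ w ∈ Vector Carrier n ] ∀ k → sum (λ j → U′ k j * w j) ≈ U (suc k) zero
    solution = forward-substitution lower-unit′ (λ k → U (suc k) zero)

    w : Vector Carrier n
    w = proj₁ solution

    b : Vector Carrier (suc n)
    b i = E zero * U zero i

    column : ∀ i → A i zero ≈ b i + sum (λ j → w j * A i (suc j))
    column i = begin
      A i zero
        ≈⟨ A≈ i zero ⟩
      E zero * (U zero i * U zero zero) + sum (λ k → E (suc k) * (U (suc k) i * U (suc k) zero))
        ≈⟨ +-cong (*-congˡ (trans (*-congˡ (unit zero)) (*-identityʳ _))) (begin
             sum (λ k → E (suc k) * (U (suc k) i * U (suc k) zero))
               ≈⟨ sum-cong-≋ (λ k → *-congˡ (*-congˡ (proj₂ solution k))) ⟨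
             sum (λ k → E (suc k) * (U (suc k) i * sum (λ j → U′ k j * w j)))
               ≈⟨ sum-cong-≋ (λ k → trans (sym (*-assoc _ _ _))
                    (*-distribˡ-sum (E (suc k) * U (suc k) i) (λ j → U′ k j * w j))) ⟩
             sum (λ k → sum (λ j → E (suc k) * U (suc k) i * (U′ k j * w j)))
               ≈⟨ ∑-comm {n} {n} _ ⟩
             sum (λ j → sum (λ k → E (suc k) * U (suc k) i * (U′ k j * w j)))
               ≈⟨ sum-cong-≋ (λ j → sum-cong-≋ λ k →
                    solve 4 (λ e u v w → e :* u :* (v :* w) := w :* (e :* (u :* v))) refl
                      (E (suc k)) (U (suc k) i) (U′ k j) (w j)) ⟩
             sum (λ j → sum (λ k → w j * (E (suc k) * (U (suc k) i * U′ k j))))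
               ≈⟨ sum-cong-≋ (λ j → trans (*-congˡ (tail-entry i j))
                    (*-distribˡ-sum (w j) (λ k → E (suc k) * (U (suc k) i * U′ k j)))) ⟨
             sum (λ j → w j * A i (suc j)) ∎) ⟩
      b i + sum (λ j → w j * A i (suc j)) ∎

-- Ordered fields and triangular factorisations

elements-member : (M : Subset n) (k : Fin ∣ M ∣) → lookup M (elements M k) ≡ true
elements-member (true ∷ M) zero = ≡.refl
elements-member (true ∷ M) (suc k) = elements-member M k
elements-member (false ∷ M) k = elements-member M k

elements-mono-< : (M : Subset n) {k l : Fin ∣ M ∣} → k Fin.< l → elements M k Fin.< elements M l
elements-mono-< (true ∷ M) {zero} {suc l} _ = s≤s z≤n
elements-mono-< (true ∷ M) {suc k} {suc l} (s≤s k<l) = s≤s (elements-mono-< M k<l)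
elements-mono-< (false ∷ M) k<l = s≤s (elements-mono-< M k<l)

elements-surjective : (M : Subset n) {a : Fin n} → lookup M a ≡ true → ∃[ k ] elements M k ≡ a
elements-surjective (true ∷ M) {zero} _ = zero , ≡.refl
elements-surjective (true ∷ M) {suc a} a∈M =
  let k , eq = elements-surjective M a∈M in suc k , ≡.cong suc eq
elements-surjective (false ∷ M) {suc a} a∈M =
  let k , eq = elements-surjective M a∈M in k , ≡.cong suc eq

elements-injective : (M : Subset n) {k l : Fin ∣ M ∣} → elements M k ≡ elements M l → k ≡ l
elements-injective (true ∷ M) {zero} {zero} _ = ≡.refl
elements-injective (true ∷ M) {suc k} {suc l} eq = ≡.cong suc (elements-injective M (Fin.suc-injective eq))
elements-injective (false ∷ M) eq = elements-injective M (Fin.suc-injective eq)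

module OrderedField {r ℓ₁ ℓ₂ ℓ₃} (ℝ : Reals r ℓ₁ ℓ₂ ℓ₃) where

  open Reals ℝ hiding (zero)
  open Determinants ℝ
  open ≈-Reasoning setoid
  open HeytingProperties heytingCommutativeRing public
    using (x-0≈x; 1#0; invertibleˡ⇒#; #-congʳ)
  open IsStrictPartialOrder isStrictPartialOrder public
    using (<-respˡ-≈; <-respʳ-≈)
    renaming (irrefl to <-irrefl; trans to <-trans; asym to <-asym)

  private module #⇔ {x y} = Equivalence (#⇔<⊎> x y)

  -- The substitute for trichotomy, inherited from cotransitivity of apartness: should `z` turn out
  -- to lie on the far side of one endpoint, it is still comparable with the other through `x < y`.
  <-cotrans : ∀ {x y} z → x < y → x < z ⊎ z < y
  <-cotrans z x<y with #-cotrans (#⇔.from (inj₁ x<y)) z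
  ... | inj₁ x#z = [ inj₁ , (λ z<x → inj₂ (<-trans z<x x<y)) ]′ (#⇔.to x#z)
  ... | inj₂ z#y = [ inj₂ , (λ y<z → inj₁ (<-trans x<y y<z)) ]′ (#⇔.to z#y)

  negative⇒0<- : ∀ {x} → x < 0# → 0# < - x
  negative⇒0<- {x} x<0 =
    <-respʳ-≈ (+-identityˡ (- x)) (<-respˡ-≈ (-‿inverseʳ x) (+-monoˡ-< (- x) x<0))

  negative²>0 : ∀ {x} → x < 0# → 0# < x * x
  negative²>0 {x} x<0 = <-respʳ-≈ -x*-x≈x*x (*-pos (negative⇒0<- x<0) (negative⇒0<- x<0))
    where
    -x*-x≈x*x : - x * - x ≈ x * x
    -x*-x≈x*x = begin
      - x * - x    ≈⟨ -‿distribˡ-* x (- x) ⟨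
      - (x * - x)  ≈⟨ -‿cong (-‿distribʳ-* x x) ⟨
      - - (x * x)  ≈⟨ -‿involutive _ ⟩
      x * x        ∎

  #0⇒0<² : ∀ {x} → x # 0# → 0# < x * x
  #0⇒0<² x#0 = [ negative²>0 , (λ 0<x → *-pos 0<x 0<x) ]′ (#⇔.to x#0)

  0<1 : 0# < 1#
  0<1 = <-respʳ-≈ (*-identityˡ 1#) (#0⇒0<² 1#0)

  1≉0 : ¬ 1# ≈ 0#
  1≉0 1≈0 = <-irrefl (sym 1≈0) 0<1

  *-reciprocal : ∀ {x} (0<x : 0# < x) → x * reciprocal ℝ 0<x ≈ 1#
  *-reciprocal {x} 0<x with #⇒invertible (#⇔.from (inj₂ 0<x))
  ... | y , _ , eq = trans (*-congʳ (sym (x-0≈x x))) eq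

  positive-cancel : ∀ {x y} → 0# < x → x * y ≈ 0# → y ≈ 0#
  positive-cancel {x} {y} 0<x xy≈0 = begin
    y                           ≈⟨ *-identityˡ y ⟨
    1# * y                      ≈⟨ *-congʳ (*-reciprocal 0<x) ⟨
    x * reciprocal ℝ 0<x * y    ≈⟨ solve 3 (λ x r y → x :* r :* y := r :* (x :* y)) refl x _ y ⟩
    reciprocal ℝ 0<x * (x * y)  ≈⟨ *-congˡ xy≈0 ⟩
    reciprocal ℝ 0<x * 0#       ≈⟨ zeroʳ _ ⟩
    0#                          ∎

  -- An inverse `z` of `x * y` provides the inverse `z * y` of `x`. Contraposition would yield only
  -- `¬ x ≈ 0#`, which is weaker than apartness.
  *#0⇒#0 : ∀ {x y} → x * y # 0# → x # 0#
  *#0⇒#0 {x} {y} xy#0 with #⇒invertible xy#0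
  ... | z , z*xy≈1 , _ = invertibleˡ⇒# (z * y , (begin
    z * y * (x - 0#)    ≈⟨ *-congˡ (x-0≈x x) ⟩
    z * y * x           ≈⟨ solve 3 (λ z y x → z :* y :* x := z :* (x :* y)) refl z y x ⟩
    z * (x * y)         ≈⟨ *-congˡ (x-0≈x _) ⟨
    z * (x * y - 0#)    ≈⟨ z*xy≈1 ⟩
    1#                  ∎))

  -- Comparing both `x + y` and 0 with `x` gives either `x # 0#` or an inverse of the difference
  -- `x + y - x`, which is `y`.
  +#0⇒#0 : ∀ {x y} → x + y # 0# → x # 0# ⊎ y # 0#
  +#0⇒#0 {x} {y} x+y#0 with #-cotrans x+y#0 x
  ... | inj₂ x#0 = inj₁ x#0
  ... | inj₁ x+y#x with #⇒invertible x+y#x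
  ...   | z , eq , _ = inj₂ (invertibleˡ⇒# (z , (begin
    z * (y - 0#)     ≈⟨ *-congˡ (x-0≈x y) ⟩
    z * y            ≈⟨ *-congˡ (begin
      x + y - x        ≈⟨ solve 3 (λ x y w → x :+ y :+ w := y :+ (x :+ w)) refl x y (- x) ⟩
      y + (x - x)      ≈⟨ trans (+-congˡ (-‿inverseʳ x)) (+-identityʳ y) ⟩
      y                ∎) ⟨
    z * (x + y - x)  ≈⟨ eq ⟩
    1#               ∎)))

  sum#0⇒#0 : (t : Vector Carrier n) → sum t # 0# → ∃[ i ] t i # 0#
  sum#0⇒#0 {zero} t 0#0 = contradiction 0#0 (#-irrefl refl)
  sum#0⇒#0 {suc n} t sum#0 with +#0⇒#0 sum#0
  ... | inj₁ t#0 = zero , t#0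
  ... | inj₂ rest#0 = let i , t#0 = sum#0⇒#0 (t ∘ suc) rest#0 in suc i , t#0

  -- Since `y < y + x`, cotransitivity at 0 leaves only the claim or the excluded `y < 0#`.
  +-pos-nonneg : ∀ {x y} → 0# < x → ¬ y < 0# → 0# < y + x
  +-pos-nonneg {x} {y} 0<x y≮0 =
    [ (λ y<0 → contradiction y<0 y≮0) , id ]′
      (<-cotrans 0# (<-respʳ-≈ (+-comm x y) (<-respˡ-≈ (+-identityˡ y) (+-monoˡ-< y 0<x))))

  +-nonneg : ∀ {x y} → ¬ x < 0# → ¬ y < 0# → ¬ x + y < 0#
  +-nonneg {x} {y} x≮0 y≮0 x+y<0 with <-cotrans x x+y<0
  ... | inj₂ x<0 = x≮0 x<0
  ... | inj₁ x+y<x = y≮0 (<-respˡ-≈ (begin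
    x + y - x    ≈⟨ solve 3 (λ x y w → x :+ y :+ w := y :+ (x :+ w)) refl x y (- x) ⟩
    y + (x - x)  ≈⟨ trans (+-congˡ (-‿inverseʳ x)) (+-identityʳ y) ⟩
    y            ∎) (<-respʳ-≈ (-‿inverseʳ x) (+-monoˡ-< (- x) x+y<x)))

  sum-nonneg : {t : Vector Carrier n} → (∀ i → ¬ t i < 0#) → ¬ sum t < 0#
  sum-nonneg {zero} _ = <-irrefl refl
  sum-nonneg {suc n} t≮0 = +-nonneg (t≮0 zero) (sum-nonneg (t≮0 ∘ suc))

  sum-pos : {t : Vector Carrier n} → (∀ i → ¬ t i < 0#) → ∀ i → 0# < t i → 0# < sum t
  sum-pos t≮0 zero 0<t = <-respʳ-≈ (+-comm _ _) (+-pos-nonneg 0<t (sum-nonneg (t≮0 ∘ suc)))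
  sum-pos t≮0 (suc i) 0<t = +-pos-nonneg (sum-pos (t≮0 ∘ suc) i 0<t) (t≮0 zero)

  -- No split on `x` being zero is needed: if `d * (x * x)` were negative it would be apart from 0,
  -- hence so would `x`, and then the product would be positive.
  scaled-square-nonneg : ∀ {d} x → 0# < d → ¬ d * (x * x) < 0#
  scaled-square-nonneg {d} x 0<d dx²<0 =
    <-asym dx²<0 (*-pos 0<d (#0⇒0<² (*#0⇒#0 (*#0⇒#0 x²d#0))))
    where
    x²d#0 : x * x * d # 0#
    x²d#0 = #⇔.from (inj₁ (<-respˡ-≈ (*-comm d (x * x)) dx²<0))

-- Matrix inverses and the factorisation LDLᵀ

module Matrices {r ℓ₁ ℓ₂ ℓ₃} (ℝ : Reals r ℓ₁ ℓ₂ ℓ₃) where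

  open Reals ℝ hiding (zero)
  open Determinants ℝ
  open OrderedField ℝ
  open ≈-Reasoning setoid

  infix 4 _≃_
  _≃_ : Rel (Matrix ℝ n) ℓ₁
  _≃_ = _≋_ ℝ

  infixl 7 _⊛_
  _⊛_ : Matrix ℝ n → Matrix ℝ n → Matrix ℝ n
  _⊛_ = _⊗_ ℝ

  infix 8 _ᵗ
  _ᵗ : Matrix ℝ n → Matrix ℝ n
  _ᵗ = _ᵀ ℝ

  I : Matrix ℝ n
  I = 𝟙 ℝ

  I-diagonal : (i : Fin n) → I i i ≈ 1#
  I-diagonal i with i Fin.≟ i
  ... | yes _ = refl
  ... | no i≢i = contradiction ≡.refl i≢i

  I-off : {i j : Fin n} → i ≢ j → I i j ≈ 0#
  I-off {i = i} {j} i≢j with i Fin.≟ j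
  ... | yes i≡j = contradiction i≡j i≢j
  ... | no _ = refl

  I-sym : (i j : Fin n) → I i j ≈ I j i
  I-sym i j with i Fin.≟ j
  ... | yes ≡.refl = sym (I-diagonal i)
  ... | no i≢j = sym (I-off (i≢j ∘ ≡.sym))

  sum-Iˡ : (i : Fin n) (t : Vector Carrier n) → sum (λ k → I i k * t k) ≈ t i
  sum-Iˡ i t = trans
    (sum-single i λ k k≢i → trans (*-congʳ (I-off (k≢i ∘ ≡.sym))) (zeroˡ _))
    (trans (*-congʳ (I-diagonal i)) (*-identityˡ _))

  sum-Iʳ : (t : Vector Carrier n) (j : Fin n) → sum (λ k → t k * I k j) ≈ t j
  sum-Iʳ t j = trans
    (sum-single j λ k k≢j → trans (*-congˡ (I-off k≢j)) (zeroʳ _))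
    (trans (*-congˡ (I-diagonal j)) (*-identityʳ _))

  sum-assoc : (t : Vector Carrier n) (A : Matrix ℝ n) (u : Vector Carrier n) →
    sum (λ k → sum (λ l → t l * A l k) * u k) ≈ sum (λ l → t l * sum (λ k → A l k * u k))
  sum-assoc {n} t A u = begin
    sum (λ k → sum (λ l → t l * A l k) * u k)
      ≈⟨ sum-cong-≋ (λ k → *-distribʳ-sum (u k) (λ l → t l * A l k)) ⟩
    sum (λ k → sum (λ l → t l * A l k * u k))
      ≈⟨ ∑-comm {n} {n} (λ k l → t l * A l k * u k) ⟩
    sum (λ l → sum (λ k → t l * A l k * u k))
      ≈⟨ sum-cong-≋ (λ l → sum-cong-≋ λ k → *-assoc (t l) (A l k) (u k)) ⟩
    sum (λ l → sum (λ k → t l * (A l k * u k)))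
      ≈⟨ sum-cong-≋ (λ l → *-distribˡ-sum (t l) (λ k → A l k * u k)) ⟨
    sum (λ l → t l * sum (λ k → A l k * u k)) ∎

  ⊛-monoid : ℕ → Monoid r ℓ₁
  ⊛-monoid n = record
    { Carrier  = Matrix ℝ n
    ; _≈_      = _≃_
    ; _∙_      = _⊛_
    ; ε        = I
    ; isMonoid = record
      { isSemigroup = record
        { isMagma = record
          { isEquivalence = record
            { refl  = λ _ _ → refl
            ; sym   = λ A≃B i j → sym (A≃B i j)
            ; trans = λ A≃B B≃C i j → trans (A≃B i j) (B≃C i j)
            }
          ; ∙-cong = λ A≃A′ B≃B′ i j → sum-cong-≋ λ k → *-cong (A≃A′ i k) (B≃B′ k j)
          }
        ; assoc = λ A B C i j → sum-assoc (A i) B (λ k → C k j)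
        }
      ; identity = (λ A i j → sum-Iˡ i (λ k → A k j)) , (λ A i j → sum-Iʳ (A i) j)
      }
    }

  ᵗ-⊛ : (A B : Matrix ℝ n) → (A ⊛ B) ᵗ ≃ B ᵗ ⊛ A ᵗ
  ᵗ-⊛ A B i j = sum-cong-≋ λ k → *-comm (A j k) (B k i)

  module _ {n : ℕ} where
    private
      module ⊛ = Monoid (⊛-monoid n)
      module R = ≈-Reasoning ⊛.setoid

    left-inverse≃right-inverse : {A B C : Matrix ℝ n} → A ⊛ B ≃ I → B ⊛ C ≃ I → A ≃ C
    left-inverse≃right-inverse {A} {B} {C} AB≃I BC≃I = R.begin
      A            R.≈⟨ ⊛.identityʳ A ⟨
      A ⊛ I        R.≈⟨ ⊛.∙-congˡ {A} BC≃I ⟨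
      A ⊛ (B ⊛ C)  R.≈⟨ ⊛.assoc A B C ⟨
      A ⊛ B ⊛ C    R.≈⟨ ⊛.∙-congʳ {C} AB≃I ⟩
      I ⊛ C        R.≈⟨ ⊛.identityˡ C ⟩
      C            R.∎

    cancel-inner : {A B A′ B′ : Matrix ℝ n} → A ⊛ A′ ≃ I → B ⊛ B′ ≃ I → A ⊛ B ⊛ (B′ ⊛ A′) ≃ I
    cancel-inner {A} {B} {A′} {B′} AA′≃I BB′≃I = R.begin
      A ⊛ B ⊛ (B′ ⊛ A′)    R.≈⟨ ⊛.assoc A B (B′ ⊛ A′) ⟩
      A ⊛ (B ⊛ (B′ ⊛ A′))  R.≈⟨ ⊛.∙-congˡ {A} (⊛.assoc B B′ A′) ⟨
      A ⊛ (B ⊛ B′ ⊛ A′)    R.≈⟨ ⊛.∙-congˡ {A} (⊛.∙-congʳ {A′} BB′≃I) ⟩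
      A ⊛ (I ⊛ A′)         R.≈⟨ ⊛.∙-congˡ {A} (⊛.identityˡ A′) ⟩
      A ⊛ A′               R.≈⟨ AA′≃I ⟩
      I                    R.∎

    inverse-⊛ : {A A′ B B′ : Matrix ℝ n} →
      IsInverse ℝ A A′ → IsInverse ℝ B B′ → IsInverse ℝ (A ⊛ B) (B′ ⊛ A′)
    inverse-⊛ {A} {A′} {B} {B′} (AA′ , A′A) (BB′ , B′B) =
      cancel-inner {A} {B} {A′} {B′} AA′ BB′ , cancel-inner {B′} {A′} {B} {A} B′B A′A

    inverse-ᵗ : {A B : Matrix ℝ n} → IsInverse ℝ A B → IsInverse ℝ (A ᵗ) (B ᵗ)
    inverse-ᵗ {A} {B} (AB , BA) =
      (λ i j → trans (sym (ᵗ-⊛ B A i j)) (trans (BA j i) (I-sym j i))) ,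
      (λ i j → trans (sym (ᵗ-⊛ A B i j)) (trans (AB j i) (I-sym j i)))

    inverse-cong : {A A′ B B′ : Matrix ℝ n} → A ≃ A′ → B ≃ B′ → IsInverse ℝ A B → IsInverse ℝ A′ B′
    inverse-cong {A} {A′} {B} {B′} A≃A′ B≃B′ (AB , BA) =
      (λ i j → trans (⊛.∙-cong {A′} {A} {B′} {B} (⊛.sym {A} A≃A′) (⊛.sym {B} B≃B′) i j) (AB i j)) ,
      (λ i j → trans (⊛.∙-cong {B′} {B} {A′} {A} (⊛.sym {B} B≃B′) (⊛.sym {A} A≃A′) i j) (BA i j))

  module _ {ℓ} {R : Rel (Fin n) ℓ} (R? : Decidable R) (R-refl : Reflexive R) (R-trans : Transitive R)
           (R⇒≥ : ∀ {i j} → R i j → j Fin.≤ i) where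

    UnitSupported : Matrix ℝ n → Set _
    UnitSupported L = (∀ i j → ¬ R i j → L i j ≈ 0#) × (∀ i → L i i ≈ 1#)

    -- Matrices supported on a preorder form its incidence algebra, and inverses stay inside.
    -- Solving LM = 1 row by row, M_ij is I_ij minus the terms L_ik M_kj with k < i, and these
    -- vanish unless `R i k` and `R k j`, which would give `R i j`. The relation is a parameter so
    -- as to cover both plain lower triangularity and the pattern of a graph.
    inverse-unitSupported : {L M : Matrix ℝ n} → L ⊛ M ≃ I → UnitSupported L → UnitSupported M
    inverse-unitSupported {L} {M} LM≃I (L≈0 , L≈1) =
      (λ i → M≈0 i (Fin.<-wellFounded i)) , M≈1
      where
      M≈I : ∀ i j → (∀ k → k ≢ i → L i k * M k j ≈ 0#) → M i j ≈ I i j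
      M≈I i j vanish = begin
        M i j                      ≈⟨ *-identityˡ _ ⟨
        1# * M i j                 ≈⟨ *-congʳ (L≈1 i) ⟨
        L i i * M i j              ≈⟨ sum-single i vanish ⟨
        sum (λ k → L i k * M k j)  ≈⟨ LM≃I i j ⟩
        I i j                      ∎

      R⇒< : ∀ {i k} → R i k → k ≢ i → k Fin.< i
      R⇒< Rik k≢i = Fin.≤∧≢⇒< (R⇒≥ Rik) k≢i

      M≈0 : ∀ i → Acc Fin._<_ i → ∀ j → ¬ R i j → M i j ≈ 0#
      M≈0 i (acc rs) j ¬Rij = trans (M≈I i j vanish) (I-off {i = i} {j} λ { ≡.refl → ¬Rij R-refl })
        where
        vanish : ∀ k → k ≢ i → L i k * M k j ≈ 0#
        vanish k k≢i with R? i k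
        ... | no ¬Rik = trans (*-congʳ (L≈0 i k ¬Rik)) (zeroˡ _)
        ... | yes Rik = trans (*-congˡ (M≈0 k (rs (R⇒< Rik k≢i)) j (¬Rij ∘ R-trans Rik))) (zeroʳ _)

      M≈1 : ∀ i → M i i ≈ 1#
      M≈1 i = trans (M≈I i i vanish) (I-diagonal i)
        where
        vanish : ∀ k → k ≢ i → L i k * M k i ≈ 0#
        vanish k k≢i with R? i k
        ... | no ¬Rik = trans (*-congʳ (L≈0 i k ¬Rik)) (zeroˡ _)
        ... | yes Rik = trans (*-congˡ (M≈0 k (Fin.<-wellFounded k) i
                          λ Rki → ℕ.<⇒≱ (R⇒< Rik k≢i) (R⇒≥ Rki))) (zeroʳ _)

  inverse-unitLower : {L M : Matrix ℝ n} → L ⊛ M ≃ I →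
    IsUnitLowerTriangular ℝ L → IsUnitLowerTriangular ℝ M
  inverse-unitLower {L = L} {M} LM≃I (L≈0 , L≈1) =
    let M≈0 , M≈1 = inverse-unitSupported (λ i j → j Fin.≤? i) ℕ.≤-refl (λ p q → ℕ.≤-trans q p) id
          {L} {M} LM≃I ((λ i j j≰i → L≈0 i j (ℕ.≰⇒> j≰i)) , L≈1)
    in (λ i j i<j → M≈0 i j (ℕ.<⇒≱ i<j)) , M≈1

  unitLower-right-inverse : (L : Matrix ℝ n) → IsUnitLowerTriangular ℝ L →
    Σ[ M ∈ Matrix ℝ n ] L ⊛ M ≃ I
  unitLower-right-inverse L unitLower =
    (λ i j → proj₁ (column j) i) , λ i j → proj₂ (column j) i
    where column = λ j → forward-substitution unitLower (λ i → I i j)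

  -- The right inverse `M` is again unit lower triangular and so has a right inverse `N` of its own.
  -- Then `L` equals `N`, which makes `M` two-sided.
  unitLower-inverse : (L : Matrix ℝ n) → IsUnitLowerTriangular ℝ L →
    Σ[ M ∈ Matrix ℝ n ] IsInverse ℝ L M × IsUnitLowerTriangular ℝ M
  unitLower-inverse {n} L L-unitLower = M , (LM≃I , ML≃I) , M-unitLower
    where
    M = proj₁ (unitLower-right-inverse L L-unitLower)
    LM≃I = proj₂ (unitLower-right-inverse L L-unitLower)
    M-unitLower : IsUnitLowerTriangular ℝ M
    M-unitLower = inverse-unitLower {L = L} {M} LM≃I L-unitLower
    N = proj₁ (unitLower-right-inverse M M-unitLower)
    MN≃I = proj₂ (unitLower-right-inverse M M-unitLower)
    L≃N : L ≃ N
    L≃N = left-inverse≃right-inverse {A = L} {M} {N} LM≃I MN≃I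
    ML≃I : M ⊛ L ≃ I
    ML≃I i j = trans (sum-cong-≋ λ k → *-congˡ (L≃N k j)) (MN≃I i j)

  diagonal : Vector Carrier n → Matrix ℝ n
  diagonal d i j = I i j * d j

  diagonal-off : (d : Vector Carrier n) → ∀ i j → i ≢ j → diagonal d i j ≈ 0#
  diagonal-off d i j i≢j = trans (*-congʳ (I-off i≢j)) (zeroˡ _)

  diagonal-entry : (d : Vector Carrier n) → ∀ i → diagonal d i i ≈ d i
  diagonal-entry d i = trans (*-congʳ (I-diagonal i)) (*-identityˡ _)

  diagonal-⊛ : {D W : Matrix ℝ n} → (∀ i j → i ≢ j → D i j ≈ 0#) → (∀ i j → i ≢ j → W i j ≈ 0#) →
    (∀ i → D i i * W i i ≈ 1#) → D ⊛ W ≃ I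
  diagonal-⊛ {D = D} {W} D≈0 W≈0 DW≈1 i j = begin
    sum (λ k → D i k * W k j)
      ≈⟨ sum-single i (λ k k≢i → trans (*-congʳ (D≈0 i k (k≢i ∘ ≡.sym))) (zeroˡ _)) ⟩
    D i i * W i j
      ≈⟨ entry ⟩
    I i j ∎
    where
    entry : D i i * W i j ≈ I i j
    entry with i Fin.≟ j
    ... | yes ≡.refl = DW≈1 i
    ... | no i≢j = trans (*-congˡ (W≈0 i j i≢j)) (zeroʳ _)

  congruence-entry : (L D : Matrix ℝ n) → (∀ i j → i ≢ j → D i j ≈ 0#) →
    ∀ i k → (L ⊛ D ⊛ L ᵗ) i k ≈ sum (λ m → D m m * (L i m * L k m))
  congruence-entry L D D≈0 i k = sum-cong-≋ λ m → begin
    sum (λ l → L i l * D l m) * L k m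
      ≈⟨ *-congʳ (sum-single m λ l l≢m → trans (*-congˡ (D≈0 l m l≢m)) (zeroʳ _)) ⟩
    L i m * D m m * L k m
      ≈⟨ solve 3 (λ x d y → x :* d :* y := d :* (x :* y)) refl (L i m) (D m m) (L k m) ⟩
    D m m * (L i m * L k m) ∎

  congruence-sym : (L D : Matrix ℝ n) → (∀ i j → i ≢ j → D i j ≈ 0#) →
    L ⊛ D ⊛ L ᵗ ≃ (L ⊛ D ⊛ L ᵗ) ᵗ
  congruence-sym L D D≈0 i k = trans (congruence-entry L D D≈0 i k)
    (trans (sum-cong-≋ λ m → *-congˡ (*-comm (L i m) (L k m))) (sym (congruence-entry L D D≈0 k i)))

  -- The inverse is MᵀWM with W the inverse of D. Any `w` inverting the diagonal is accepted, so
  -- that `D = I` can take the literal `1#` in place of an opaque `reciprocal`.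
  congruence-inverse : {S L D M : Matrix ℝ n} (w : Vector Carrier n) →
    S ≃ L ⊛ D ⊛ L ᵗ → IsInverse ℝ L M →
    (∀ i j → i ≢ j → D i j ≈ 0#) → (∀ i → D i i * w i ≈ 1#) →
    IsInverse ℝ S (λ i j → sum (λ k → w k * (M k i * M k j)))
  congruence-inverse {n} {S} {L} {D} {M} w S≃ L-inverse D≈0 Dw≈1 =
    inverse-cong {A = L ⊛ D ⊛ L ᵗ} {S} {M ᵗ ⊛ (W ⊛ M)} (λ i j → sym (S≃ i j)) entry
      (inverse-⊛ {A = L ⊛ D} {W ⊛ M} {L ᵗ} {M ᵗ}
        (inverse-⊛ {A = L} {M} {D} {W} L-inverse D-inverse) (inverse-ᵗ {A = L} {M} L-inverse))
    where
    W : Matrix ℝ n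
    W = diagonal w

    D-inverse : IsInverse ℝ D W
    D-inverse =
      diagonal-⊛ D≈0 (diagonal-off w) (λ i → trans (*-congˡ (diagonal-entry w i)) (Dw≈1 i)) ,
      diagonal-⊛ (diagonal-off w) D≈0
        (λ i → trans (*-congʳ (diagonal-entry w i)) (trans (*-comm _ _) (Dw≈1 i)))

    entry : M ᵗ ⊛ (W ⊛ M) ≃ (λ i j → sum (λ k → w k * (M k i * M k j)))
    entry i j = begin
      (M ᵗ ⊛ (W ⊛ M)) i j
        ≈⟨ Monoid.assoc (⊛-monoid n) (M ᵗ) W M i j ⟨
      (M ᵗ ⊛ W ⊛ M) i j
        ≈⟨ congruence-entry (M ᵗ) W (diagonal-off w) i j ⟩
      sum (λ k → W k k * (M k i * M k j))
        ≈⟨ sum-cong-≋ (λ k → *-congʳ (diagonal-entry w k)) ⟩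
      sum (λ k → w k * (M k i * M k j)) ∎

  -- With y = Lᵀx the quadratic form becomes the sum of D_mm y_m². As x = Mᵀy, an entry of x apart
  -- from 0 forces some y_m to be apart from 0.
  congruence-positiveDefinite : {L D M : Matrix ℝ n} → IsPositiveDiagonal ℝ D → L ⊛ M ≃ I →
    IsPositiveDefinite ℝ (L ⊛ D ⊛ L ᵗ)
  congruence-positiveDefinite {n} {L} {D} {M} (D≈0 , D>0) LM≃I x (i , xᵢ#0) =
    <-respʳ-≈ (sym quadratic)
      (sum-pos (λ m → scaled-square-nonneg (y m) (D>0 m)) (proj₁ y#0)
        (*-pos (D>0 (proj₁ y#0)) (#0⇒0<² (proj₂ y#0))))
    where
    y : Vector Carrier n
    y m = sum (λ l → x l * L l m)

    yM≈x : sum (λ m → y m * M m i) ≈ x i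
    yM≈x = begin
      sum (λ m → y m * M m i)
        ≈⟨ sum-assoc x L (λ m → M m i) ⟩
      sum (λ l → x l * (L ⊛ M) l i)
        ≈⟨ sum-cong-≋ (λ l → *-congˡ (LM≃I l i)) ⟩
      sum (λ l → x l * I l i)
        ≈⟨ sum-Iʳ x i ⟩
      x i ∎

    y#0 : ∃[ m ] y m # 0#
    y#0 =
      let m , yM#0 = sum#0⇒#0 (λ m → y m * M m i) (#-congʳ (sym yM≈x) xᵢ#0)
      in m , *#0⇒#0 yM#0

    quadratic : sum (λ i → sum (λ j → x i * (L ⊛ D ⊛ L ᵗ) i j * x j)) ≈ sum (λ m → D m m * (y m * y m))
    quadratic = begin
      sum (λ i → sum (λ j → x i * (L ⊛ D ⊛ L ᵗ) i j * x j))
        ≈⟨ sum-cong-≋ (λ i → sum-cong-≋ λ j → begin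
             x i * (L ⊛ D ⊛ L ᵗ) i j * x j
               ≈⟨ trans (*-congʳ (*-congˡ (congruence-entry L D D≈0 i j)))
                    (solve 3 (λ x s y → x :* s :* y := x :* y :* s) refl (x i) _ (x j)) ⟩
             x i * x j * sum (λ m → D m m * (L i m * L j m))
               ≈⟨ *-distribˡ-sum (x i * x j) (λ m → D m m * (L i m * L j m)) ⟩
             sum (λ m → x i * x j * (D m m * (L i m * L j m)))
               ≈⟨ sum-cong-≋ (λ m → solve 5
                    (λ x y d u v → x :* y :* (d :* (u :* v)) := d :* (x :* u) :* (y :* v)) refl
                    (x i) (x j) (D m m) (L i m) (L j m)) ⟩
             sum (λ m → D m m * (x i * L i m) * (x j * L j m)) ∎) ⟩
      sum (λ i → sum (λ j → sum (λ m → D m m * (x i * L i m) * (x j * L j m))))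
        ≈⟨ sum-cong-≋ (λ i → ∑-comm {n} {n} (λ j m → D m m * (x i * L i m) * (x j * L j m))) ⟩
      sum (λ i → sum (λ m → sum (λ j → D m m * (x i * L i m) * (x j * L j m))))
        ≈⟨ sum-cong-≋ (λ i → sum-cong-≋ λ m →
             *-distribˡ-sum (D m m * (x i * L i m)) (λ j → x j * L j m)) ⟨
      sum (λ i → sum (λ m → D m m * (x i * L i m) * y m))
        ≈⟨ ∑-comm {n} {n} (λ i m → D m m * (x i * L i m) * y m) ⟩
      sum (λ m → sum (λ i → D m m * (x i * L i m) * y m))
        ≈⟨ sum-cong-≋ (λ m → begin
             sum (λ i → D m m * (x i * L i m) * y m)
               ≈⟨ sum-cong-≋ (λ i → solve 3 (λ d a y → d :* a :* y := d :* y :* a) refl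
                    (D m m) (x i * L i m) (y m)) ⟩
             sum (λ i → D m m * y m * (x i * L i m))
               ≈⟨ *-distribˡ-sum (D m m * y m) (λ i → x i * L i m) ⟨
             D m m * y m * y m
               ≈⟨ *-assoc _ _ _ ⟩
             D m m * (y m * y m) ∎) ⟩
      sum (λ m → D m m * (y m * y m)) ∎

  sum-elements : (C : Subset n) (t : Vector Carrier n) → (∀ a → lookup C a ≢ true → t a ≈ 0#) →
    sum t ≈ sum (t ∘ elements C)
  sum-elements [] t _ = refl
  sum-elements (true ∷ C) t t≈0 = +-congˡ (sum-elements C (t ∘ suc) (t≈0 ∘ suc))
  sum-elements (false ∷ C) t t≈0 =
    trans (+-cong (t≈0 zero λ ()) (sum-elements C (t ∘ suc) (t≈0 ∘ suc))) (+-identityˡ _)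

  -- The vanishing hypothesis cuts the sum over all rows down to the rows in `C`. It concerns the
  -- product `E k * M k i` because either factor may be responsible: the entry of `M` when the
  -- pattern of the graph forbids it, or a weight `E k` chosen to be zero in the counterexamples.
  -- There, too, the formula for `A` is available only for indices in `C`.
  det-principal : (C : Subset n) {A M : Matrix ℝ n} (E : Vector Carrier n) →
    IsUnitLowerTriangular ℝ M →
    (∀ {i j} → lookup C i ≡ true → lookup C j ≡ true → A i j ≈ sum (λ k → E k * (M k i * M k j))) →
    (∀ {k i} → lookup C k ≢ true → lookup C i ≡ true → E k * M k i ≈ 0#) →
    det ℝ (principal ℝ A C) ≈ product (E ∘ elements C)
  det-principal C {A} {M} E (M≈0 , M≈1) A≈ EM≈0 =
    det-congruence {U = principal ℝ M C} {principal ℝ A C} (E ∘ elements C)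
      ((λ k l k<l → M≈0 _ _ (elements-mono-< C k<l)) , λ k → M≈1 _) λ k l →
      let i = elements C k
          j = elements C l
      in trans (A≈ (elements-member C k) (elements-member C l))
        (sum-elements C (λ m → E m * (M m i * M m j)) λ m m∉C →
          trans (sym (*-assoc (E m) (M m i) (M m j)))
            (trans (*-congʳ (EM≈0 m∉C (elements-member C k))) (zeroˡ _)))

-- Graphs

module OrderedGraph {v e p} {V : Set v} (G : Graph V e) (σ : Ordering V p) where

  open Graph G public
  open Inverse σ public
    using () renaming (to to pos; from to vtx; strictlyInverseʳ to vtx-pos; strictlyInverseˡ to pos-vtx)

  Adj : Rel (Fin p) e
  Adj i j = E (vtx i) (vtx j)

  Adj? : Decidable Adj
  Adj? i j = E? (vtx i) (vtx j)

  Adj⇒≢ : ∀ {i j} → Adj i j → i ≢ j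
  Adj⇒≢ adj ≡.refl = E-irrefl adj

  vtx-injective : ∀ {i j} → vtx i ≡ vtx j → i ≡ j
  vtx-injective {i} {j} eq = ≡.trans (≡.sym (pos-vtx i)) (≡.trans (≡.cong pos eq) (pos-vtx j))

  pos-injective : ∀ {u w} → pos u ≡ pos w → u ≡ w
  pos-injective {u} {w} eq = ≡.trans (≡.sym (vtx-pos u)) (≡.trans (≡.cong vtx eq) (vtx-pos w))

  E⇒Adj : ∀ {u w} → E u w → Adj (pos u) (pos w)
  E⇒Adj {u} {w} = ≡.subst₂ E (≡.sym (vtx-pos u)) (≡.sym (vtx-pos w))

  Adj⇒E : ∀ {u w} → Adj (pos u) (pos w) → E u w
  Adj⇒E {u} {w} = ≡.subst₂ E (vtx-pos u) (vtx-pos w)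

  _≟ᵛ_ : DecidableEquality V
  u ≟ᵛ w = map′ pos-injective (≡.cong pos) (pos u Fin.≟ pos w)

  -- N[j] ⊆ N[i] whenever j < i are adjacent.
  Nested : Set e
  Nested = ∀ {i j k} → j Fin.< i → Adj i j → Adj j k → k ≢ i → Adj i k

  -- If i and k were not adjacent, k would lie in N[j] but not in N[i]. Homogeneity then leaves only
  -- N[i] ⊆ N[j], an inclusion between different R-classes, and the scheme would place j after i.
  homogeneous∧hasse⇒nested : IsHomogeneous → IsHasseTreeScheme G σ → Nested
  homogeneous∧hasse⇒nested homogeneous hasse {i} {j} {k} j<i ij jk k≢i with Adj? i k
  ... | yes ik = ik
  ... | no ¬ik with homogeneous (vtx i) (vtx j) ij
  ...   | inj₁ N[j]⊆N[i] =
    [ (λ eq → contradiction (vtx-injective eq) k≢i) , E-sym ]′ (N[j]⊆N[i] (inj₂ (E-sym jk)))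
  ...   | inj₂ j⟶i = contradiction
    (≡.subst₂ Fin._<_ (pos-vtx i) (pos-vtx j) (hasse (vtx j) (vtx i) j⟶i λ (_ , i⟶j) →
      ¬ik ([ (λ eq → contradiction (vtx-injective eq) k≢i) , E-sym ]′ (i⟶j (inj₂ (E-sym jk))))))
    (ℕ.<-asym j<i)

  nested⇒⟶ : Nested → ∀ {u w} → pos w Fin.< pos u → E u w → u ⟶ w
  nested⇒⟶ nested w<u uw (inj₁ ≡.refl) = inj₂ (E-sym uw)
  nested⇒⟶ nested {u} w<u uw {x} (inj₂ xw) with x ≟ᵛ u
  ... | yes x≡u = inj₁ x≡u
  ... | no x≢u = inj₂ (E-sym (Adj⇒E (nested w<u (E⇒Adj uw) (E⇒Adj (E-sym xw)) (x≢u ∘ pos-injective))))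

  nested⇒homogeneous : Nested → IsHomogeneous
  nested⇒homogeneous nested u w uw with Fin.<-cmp (pos u) (pos w)
  ... | tri< u<w _ _ = inj₂ (nested⇒⟶ nested u<w (E-sym uw))
  ... | tri> _ _ w<u = inj₁ (nested⇒⟶ nested w<u uw)
  ... | tri≈ _ eq _ = contradiction eq (Adj⇒≢ (E⇒Adj uw))

  -- Since w lies in N[w], the arrow makes u and w equal or adjacent. Were u placed before w,
  -- nesting would supply the reverse arrow and hence `u R w`.
  nested⇒hasse : Nested → IsHasseTreeScheme G σ
  nested⇒hasse nested u w u⟶w ¬uRw with u⟶w (inj₁ ≡.refl)
  ... | inj₁ ≡.refl = ⊥-elim (¬uRw (id , id))
  ... | inj₂ wu with Fin.<-cmp (pos u) (pos w)
  ...   | tri< u<w _ _ = ⊥-elim (¬uRw (u⟶w , nested⇒⟶ nested u<w wu))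
  ...   | tri> _ _ w<u = w<u
  ...   | tri≈ _ eq _ = contradiction (≡.sym eq) (Adj⇒≢ (E⇒Adj wu))

  -- Cliques and their maximal extensions

  AdjacentToAll : VertexSet → V → Set _
  AdjacentToAll C u = ∀ w → members C w → w ≢ u → E w u

  adjacentToAll? : ∀ C u → Dec (AdjacentToAll C u)
  adjacentToAll? C u = map′
    (λ f w → ≡.subst (λ w → members C w → w ≢ u → E w u) (vtx-pos w) (f (pos w)))
    (λ f k → f (vtx k))
    (Fin.all? λ k → T? (C (vtx k)) →-dec ¬? (vtx k ≟ᵛ u) →-dec E? (vtx k) u)

  insert : V → VertexSet → VertexSet
  insert u C w = C w ∨ isYes (w ≟ᵛ u)

  insert-⊇ : ∀ {u C} → members C ⊆ members (insert u C)
  insert-⊇ w∈C = Equivalence.from T-∨ (inj₁ w∈C)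

  insert-self : ∀ {u C} → members (insert u C) u
  insert-self {u} = Equivalence.from T-∨ (inj₂ (fromWitness {a? = u ≟ᵛ u} ≡.refl))

  insert⁻ : ∀ {u C w} → members (insert u C) w → members C w ⊎ w ≡ u
  insert⁻ {u} {w = w} w∈ = [ inj₁ , inj₂ ∘ toWitness {a? = w ≟ᵛ u} ]′ (Equivalence.to T-∨ w∈)

  insert-clique : ∀ {u C} → IsClique C → AdjacentToAll C u → IsClique (insert u C)
  insert-clique {C = C} clique adjacent x y x∈ y∈ x≢y with insert⁻ {C = C} x∈ | insert⁻ {C = C} y∈
  ... | inj₁ x∈C | inj₁ y∈C = clique x y x∈C y∈C x≢y
  ... | inj₁ x∈C | inj₂ ≡.refl = adjacent x x∈C x≢y
  ... | inj₂ ≡.refl | inj₁ y∈C = E-sym (adjacent y y∈C (x≢y ∘ ≡.sym))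
  ... | inj₂ ≡.refl | inj₂ ≡.refl = contradiction ≡.refl x≢y

  extend : List V → VertexSet → VertexSet
  extend [] C = C
  extend (u ∷ us) C with adjacentToAll? C u
  ... | yes _ = extend us (insert u C)
  ... | no _ = extend us C

  extend-⊇ : ∀ us {C} → members C ⊆ members (extend us C)
  extend-⊇ [] = id
  extend-⊇ (u ∷ us) {C} with adjacentToAll? C u
  ... | yes _ = extend-⊇ us ∘ insert-⊇ {u} {C}
  ... | no _ = extend-⊇ us

  extend-clique : ∀ us {C} → IsClique C → IsClique (extend us C)
  extend-clique [] clique = clique
  extend-clique (u ∷ us) {C} clique with adjacentToAll? C u
  ... | yes adjacent = extend-clique us (insert-clique {u} {C} clique adjacent)
  ... | no _ = extend-clique us clique

  -- One greedy pass is enough: a vertex adjacent to all of the final set was adjacent to all of the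
  -- smaller set met at its turn, so it was inserted then.
  extend-saturated : ∀ us {C u} → u ∈ us → AdjacentToAll (extend us C) u → members (extend us C) u
  extend-saturated (u ∷ us) {C} u∈ adjacent with adjacentToAll? C u | u∈
  ... | yes _ | here ≡.refl = extend-⊇ us (insert-self {u} {C})
  ... | no ¬adjacent | here ≡.refl = contradiction (λ w → adjacent w ∘ extend-⊇ us) ¬adjacent
  ... | yes _ | there u∈us = extend-saturated us u∈us adjacent
  ... | no _ | there u∈us = extend-saturated us u∈us adjacent

  -- Condition 3 speaks only of maximal cliques, so the edge used in a counterexample has to be
  -- enlarged to one.
  clique⊆maximalClique : ∀ C → IsClique C → ∃[ C′ ] IsMaximalClique C′ × members C ⊆ members C′
  clique⊆maximalClique C clique =
    extend us C , (extend-clique us clique , maximal) , λ {u} → extend-⊇ us {x = u}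
    where
    us = List.map vtx (List.allFin p)

    ∈us : ∀ u → u ∈ us
    ∈us u = ≡.subst (_∈ us) (vtx-pos u) (∈-map⁺ vtx (∈-allFin (pos u)))

    maximal : ∀ C′ → IsClique C′ → _
    maximal C′ clique′ (⊆C′ , C′⊈) = C′⊈ λ {u} u∈C′ →
      extend-saturated us (∈us u) λ w w∈ → clique′ w u (⊆C′ w∈) u∈C′

  pair-clique : ∀ {u w} → E u w → IsClique (insert u (insert w (const false)))
  pair-clique {u} {w} uw = insert-clique {u} {insert w (const false)}
    (insert-clique {w} {const false} (λ _ _ ()) (λ _ ()))
    λ x x∈ _ → [ (λ ()) , (λ { ≡.refl → E-sym uw }) ]′ (insert⁻ {w} {const false} x∈)

  -- Nesting gives C ⊆ N[i] ⊆ N[k], so C together with k is still a clique, and maximality puts k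
  -- into C.
  nested⇒maximalClique-upward : Nested → ∀ {C} → IsMaximalClique C →
    ∀ {i k} → members C (vtx i) → i Fin.< k → Adj k i → members C (vtx k)
  nested⇒maximalClique-upward nested {C} (clique , maximal) {i} {k} i∈C i<k ki with T? (C (vtx k))
  ... | yes k∈C = k∈C
  ... | no k∉C = contradiction
    ((λ {u} → insert-⊇ {vtx k} {C} {u}) , λ insert⊆C → k∉C (insert⊆C (insert-self {vtx k} {C})))
    (maximal (insert (vtx k) C) (insert-clique {vtx k} {C} clique adjacent))
    where
    adjacent : AdjacentToAll C (vtx k)
    adjacent w w∈C w≢k with w ≟ᵛ vtx i
    ... | yes ≡.refl = E-sym ki
    ... | no w≢i = E-sym (≡.subst (E (vtx k)) (vtx-pos w)
      (nested i<k ki (≡.subst (E (vtx i)) (≡.sym (vtx-pos w)) (clique (vtx i) w i∈C w∈C (w≢i ∘ ≡.sym)))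
        λ pos-w≡k → w≢k (≡.trans (≡.sym (vtx-pos w)) (≡.cong vtx pos-w≡k))))

  lookup-image⁻ : ∀ C {k} → lookup (image G σ C) k ≡ true → members C (vtx k)
  lookup-image⁻ C {k} eq = Equivalence.from T-≡ (≡.trans (≡.sym (lookup∘tabulate (C ∘ vtx) k)) eq)

  lookup-image⁺ : ∀ C {k} → members C (vtx k) → lookup (image G σ C) k ≡ true
  lookup-image⁺ C {k} k∈C = ≡.trans (lookup∘tabulate (C ∘ vtx) k) (Equivalence.to T-≡ k∈C)

-- The equivalences

module Equivalences {r ℓ₁ ℓ₂ ℓ₃ v e} (ℝ : Reals r ℓ₁ ℓ₂ ℓ₃) {V : Set v} (G : Graph V e)
                    {p : ℕ} (σ : Ordering V p) where

  open Reals ℝ hiding (zero)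
  open Determinants ℝ
  open OrderedField ℝ
  open Matrices ℝ
  open OrderedGraph G σ
  open ≈-Reasoning setoid

  -- The diagonal is included so that, under `Nested`, this is a preorder and
  -- `inverse-unitSupported` applies.
  Support : Rel (Fin p) e
  Support i j = i ≡ j ⊎ (j Fin.< i × Adj i j)

  support? : Decidable Support
  support? i j = (i Fin.≟ j) ⊎-dec (j Fin.<? i ×-dec Adj? i j)

  support⇒≥ : ∀ {i j} → Support i j → j Fin.≤ i
  support⇒≥ (inj₁ ≡.refl) = ℕ.≤-refl
  support⇒≥ (inj₂ (j<i , _)) = ℕ.<⇒≤ j<i

  support-trans : Nested → Transitive Support
  support-trans nested (inj₁ ≡.refl) jk = jk
  support-trans nested ij (inj₁ ≡.refl) = ij
  support-trans nested (inj₂ (j<i , ij)) (inj₂ (k<j , jk)) =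
    inj₂ (ℕ.<-trans k<j j<i , nested j<i ij jk λ { ≡.refl → ℕ.<-asym k<j j<i })

  -- Entry (i, k) of LDLᵀ collects products L_im L_km, so rows i and k meeting in a column m must be
  -- adjacent if the zeros are to survive.
  support-fill : Nested → ∀ {i k m} → Support i m → Support k m → i ≢ k → Adj i k
  support-fill nested (inj₁ ≡.refl) (inj₁ ≡.refl) i≢k = contradiction ≡.refl i≢k
  support-fill nested (inj₁ ≡.refl) (inj₂ (_ , ki)) _ = E-sym ki
  support-fill nested (inj₂ (_ , ik)) (inj₁ ≡.refl) _ = ik
  support-fill nested (inj₂ (m<i , im)) (inj₂ (_ , km)) i≢k = nested m<i im (E-sym km) (i≢k ∘ ≡.sym)

  ZeroOffSupport : Matrix ℝ p → Set _
  ZeroOffSupport L = ∀ i j → ¬ Support i j → L i j ≈ 0#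

  𝓛⇒zeroOffSupport : ∀ {L} → 𝓛 ℝ G σ L → ZeroOffSupport L
  𝓛⇒zeroOffSupport ((L≈0 , _) , L≈0′) i j ¬support with Fin.<-cmp i j
  ... | tri< i<j _ _ = L≈0 i j i<j
  ... | tri≈ _ i≡j _ = contradiction (inj₁ i≡j) ¬support
  ... | tri> _ _ j<i = L≈0′ i j j<i λ ij → ¬support (inj₂ (j<i , ij))

  zeroOffSupport⇒𝓛 : ∀ {L} → IsUnitLowerTriangular ℝ L → ZeroOffSupport L → 𝓛 ℝ G σ L
  zeroOffSupport⇒𝓛 unitLower L≈0 = unitLower , λ i j j<i ¬ij →
    L≈0 i j λ { (inj₁ ≡.refl) → ℕ.<-irrefl ≡.refl j<i; (inj₂ (_ , ij)) → ¬ij ij }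

  ZeroOffEdges : Matrix ℝ p → Set _
  ZeroOffEdges S = ∀ i j → i ≢ j → NonEdge G σ i j → S i j ≈ 0#

  inverse-𝓛 : Nested → ∀ {L M} → L ⊛ M ≃ I → 𝓛 ℝ G σ L → 𝓛 ℝ G σ M
  inverse-𝓛 nested {L} {M} LM≃I L∈𝓛@(unitLower , _) =
    zeroOffSupport⇒𝓛 (inverse-unitLower {L = L} {M} LM≃I unitLower)
      (proj₁ (inverse-unitSupported support? (inj₁ ≡.refl) (support-trans nested) support⇒≥
        {L} {M} LM≃I (𝓛⇒zeroOffSupport L∈𝓛 , proj₂ unitLower)))

  𝓛⇒zeroOffEdges : Nested → ∀ {L D} → IsPositiveDiagonal ℝ D → 𝓛 ℝ G σ L → ZeroOffEdges (L ⊛ D ⊛ L ᵗ)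
  𝓛⇒zeroOffEdges nested {L} {D} (D≈0 , _) L∈𝓛 i k i≢k ¬ik =
    trans (congruence-entry L D D≈0 i k) (sum-zero λ m → trans (*-congˡ (vanish m)) (zeroʳ _))
    where
    vanish : ∀ m → L i m * L k m ≈ 0#
    vanish m with support? i m | support? k m
    ... | no ¬im | _ = trans (*-congʳ (𝓛⇒zeroOffSupport L∈𝓛 i m ¬im)) (zeroˡ _)
    ... | yes _ | no ¬km = trans (*-congˡ (𝓛⇒zeroOffSupport L∈𝓛 k m ¬km)) (zeroʳ _)
    ... | yes im | yes km = contradiction (support-fill nested im km i≢k) ¬ik

  -- Induction on the column j: entry (i, j) of LDLᵀ is D_jj L_ij plus the terms D_mm L_im L_jm with
  -- m < j. By induction such a term can be nonzero only if m is adjacent to both i and j, and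
  -- nesting would then join i to j. What remains is D_jj L_ij, and D_jj cancels.
  zeroOffEdges⇒𝓛 : Nested → ∀ {L D} → IsPositiveDiagonal ℝ D → IsUnitLowerTriangular ℝ L →
    ZeroOffEdges (L ⊛ D ⊛ L ᵗ) → 𝓛 ℝ G σ L
  zeroOffEdges⇒𝓛 nested {L} {D} (D≈0 , D>0) unitLower@(L≈0 , L≈1) S≈0 =
    unitLower , λ i j j<i ¬ij → column j (Fin.<-wellFounded j) i j<i ¬ij
    where
    column : ∀ j → Acc Fin._<_ j → ∀ i → j Fin.< i → ¬ Adj i j → L i j ≈ 0#
    column j (acc rs) i j<i ¬ij = positive-cancel (D>0 j) (begin
      D j j * L i j                            ≈⟨ *-congˡ (*-identityʳ _) ⟨
      D j j * (L i j * 1#)                     ≈⟨ *-congˡ (*-congˡ (L≈1 j)) ⟨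
      D j j * (L i j * L j j)                  ≈⟨ sum-single j vanish ⟨
      sum (λ m → D m m * (L i m * L j m))      ≈⟨ congruence-entry L D D≈0 i j ⟨
      (L ⊛ D ⊛ L ᵗ) i j                        ≈⟨ S≈0 i j i≢j ¬ij ⟩
      0#                                       ∎)
      where
      i≢j : i ≢ j
      i≢j ≡.refl = ℕ.<-irrefl ≡.refl j<i

      vanish : ∀ m → m ≢ j → D m m * (L i m * L j m) ≈ 0#
      vanish m m≢j = trans (*-congˡ product≈0) (zeroʳ _)
        where
        product≈0 : L i m * L j m ≈ 0#
        product≈0 with Fin.<-cmp m j
        ... | tri≈ _ m≡j _ = contradiction m≡j m≢j
        ... | tri> _ _ j<m = trans (*-congˡ (L≈0 j m j<m)) (zeroʳ _)
        ... | tri< m<j _ _ with Adj? i m | Adj? j m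
        ...   | no ¬im | _ = trans (*-congʳ (column m (rs m<j) i (ℕ.<-trans m<j j<i) ¬im)) (zeroˡ _)
        ...   | yes _ | no ¬jm = trans (*-congˡ (column m (rs m<j) j m<j ¬jm)) (zeroʳ _)
        ...   | yes im | yes jm = contradiction
          (nested (ℕ.<-trans m<j j<i) im (E-sym jm) (i≢j ∘ ≡.sym)) ¬ij

  congruence-𝓟 : ∀ {L D M} → IsPositiveDiagonal ℝ D → L ⊛ M ≃ I → ZeroOffEdges (L ⊛ D ⊛ L ᵗ) →
    𝓟 ℝ G σ (L ⊛ D ⊛ L ᵗ)
  congruence-𝓟 {L} {D} {M} D-positive@(D≈0 , _) LM≃I S≈0 =
    congruence-sym L D D≈0 , congruence-positiveDefinite {L = L} {D} {M} D-positive LM≃I , S≈0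

  nested⇒zerosPreserved : Nested → ZerosPreserved ℝ G σ
  nested⇒zerosPreserved nested D L M D-positive unitLower (LM≃I , ML≃I) =
    mk⇔ (inverse-𝓛 nested {L} {M} LM≃I) (inverse-𝓛 nested {M} {L} ML≃I) ,
    mk⇔ (λ M∈𝓛 → congruence-𝓟 {L} {D} {M} D-positive LM≃I
               (𝓛⇒zeroOffEdges nested {L} {D} D-positive (inverse-𝓛 nested {M} {L} ML≃I M∈𝓛)))
        (λ (_ , _ , S≈0) → inverse-𝓛 nested {L} {M} LM≃I
               (zeroOffEdges⇒𝓛 nested {L} {D} D-positive unitLower S≈0))

  nested⇒cliqueDeterminants : Nested → CliqueDeterminants ℝ G σ
  nested⇒cliqueDeterminants nested S A L D (_ , _ , S≈0) (_ , AS≃I)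
    (unitLower , D-positive@(D≈0 , D>0) , S≃) C C-maximal
    with unitLower-inverse L unitLower
  ... | M , L-inverse@(LM≃I , _) , M-unitLower =
    det-principal (image G σ C) {A} {M} w M-unitLower (λ {i} {j} _ _ → A≃ i j) vanish
    where
    w : Vector Carrier p
    w k = reciprocal ℝ (D>0 k)

    A≃ : A ≃ (λ i j → sum (λ k → w k * (M k i * M k j)))
    A≃ = left-inverse≃right-inverse {A = A} {S} AS≃I
      (proj₁ (congruence-inverse {S = S} {L} {D} {M} w S≃ L-inverse D≈0 (λ i → *-reciprocal (D>0 i))))

    M∈𝓛 : 𝓛 ℝ G σ M
    M∈𝓛 = inverse-𝓛 nested {L} {M} LM≃I (zeroOffEdges⇒𝓛 nested {L} {D} D-positive unitLower
      λ i j i≢j ¬ij → trans (sym (S≃ i j)) (S≈0 i j i≢j ¬ij))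

    -- For i in C, column i of `M` lives on i and its later neighbours, all of which belong to C.
    vanish : ∀ {k i} → lookup (image G σ C) k ≢ true → lookup (image G σ C) i ≡ true → w k * M k i ≈ 0#
    vanish {k} {i} k∉C i∈C = trans (*-congˡ (𝓛⇒zeroOffSupport M∈𝓛 k i λ where
      (inj₁ ≡.refl) → k∉C i∈C
      (inj₂ (i<k , ki)) → k∉C (lookup-image⁺ C
        (nested⇒maximalClique-upward nested C-maximal (lookup-image⁻ C i∈C) i<k ki)))) (zeroʳ _)

  -- Counterexamples that alter two rows of the identity

  I-positiveDiagonal : IsPositiveDiagonal ℝ (I {n = p})
  I-positiveDiagonal = (λ i j → I-off) , λ i → <-respʳ-≈ (sym (I-diagonal i)) 0<1

  withRows : Fin p → Vector Carrier p → Fin p → Vector Carrier p → Matrix ℝ p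
  withRows i x k y = updateAt (updateAt I i (const x)) k (const y)

  module _ {i k : Fin p} {x y : Vector Carrier p} where

    withRows-first : i ≢ k → withRows i x k y i ≡ x
    withRows-first i≢k = ≡.trans
      (Vector.updateAt-minimal i k (updateAt I i (const x)) i≢k) (Vector.updateAt-updates i I)

    withRows-second : withRows i x k y k ≡ y
    withRows-second = Vector.updateAt-updates k (updateAt I i (const x))

    withRows-other : ∀ {a} → a ≢ i → a ≢ k → withRows i x k y a ≡ I a
    withRows-other {a} a≢i a≢k = ≡.trans
      (Vector.updateAt-minimal a k (updateAt I i (const x)) a≢k) (Vector.updateAt-minimal a i I a≢i)

    -- Triangularity and the zero patterns are conditions on single rows, so it suffices to check
    -- the two new rows and an identity row.
    withRows-all : ∀ {ℓ} (P : Fin p → Vector Carrier p → Set ℓ) → P i x → P k y →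
      (∀ a → a ≢ i → a ≢ k → P a (I a)) → ∀ a → P a (withRows i x k y a)
    withRows-all P Pi Pk P-other a with a Fin.≟ k | a Fin.≟ i
    ... | yes ≡.refl | _ = ≡.subst (P a) (≡.sym withRows-second) Pk
    ... | no a≢k | yes ≡.refl = ≡.subst (P a) (≡.sym (withRows-first a≢k)) Pi
    ... | no a≢k | no a≢i = ≡.subst (P a) (≡.sym (withRows-other a≢i a≢k)) (P-other a a≢i a≢k)

  UnitLowerRow : Fin p → Vector Carrier p → Set _
  UnitLowerRow a t = (∀ b → a Fin.< b → t b ≈ 0#) × t a ≈ 1#

  ZeroOffEdgesRow : Fin p → Vector Carrier p → Set _
  ZeroOffEdgesRow a t = ∀ b → a ≢ b → ¬ Adj a b → t b ≈ 0#

  withRows-unitLower : ∀ {i x k y} → UnitLowerRow i x → UnitLowerRow k y →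
    IsUnitLowerTriangular ℝ (withRows i x k y)
  withRows-unitLower {i} {x} {k} {y} x-row y-row = proj₁ ∘ rows , proj₂ ∘ rows
    where rows = withRows-all {i} {k} {x} {y} UnitLowerRow x-row y-row
                   λ a _ _ → (λ b a<b → I-off (Fin.<⇒≢ a<b)) , I-diagonal a

  withRows-zeroOffEdges : ∀ {i x k y} → ZeroOffEdgesRow i x → ZeroOffEdgesRow k y →
    ZeroOffEdges (withRows i x k y)
  withRows-zeroOffEdges {i} {x} {k} {y} x-row y-row =
    withRows-all {i} {k} {x} {y} ZeroOffEdgesRow x-row y-row λ a _ _ b a≢b _ → I-off a≢b

  I⊕ : Fin p → Fin p → Vector Carrier p
  I⊕ i j m = I i m + I j m

  I⊕-unitLower : ∀ {i j} → j Fin.< i → UnitLowerRow i (I⊕ i j)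
  I⊕-unitLower {i} {j} j<i =
    (λ b i<b → trans (+-cong (I-off (Fin.<⇒≢ i<b)) (I-off (Fin.<⇒≢ (ℕ.<-trans j<i i<b)))) (+-identityʳ _)) ,
    trans (+-cong (I-diagonal i) (I-off (Fin.<⇒≢ j<i))) (+-identityʳ _)

  I⊕-zeroOffEdges : ∀ {i j} → Adj i j → ZeroOffEdgesRow i (I⊕ i j)
  I⊕-zeroOffEdges {i} {j} ij b i≢b ¬ib =
    trans (+-cong (I-off i≢b) (I-off {i = j} {b} λ { ≡.refl → ¬ib ij })) (+-identityʳ _)

  sum-I⊕ : ∀ i j (t : Vector Carrier p) → sum (λ m → I⊕ i j m * t m) ≈ t i + t j
  sum-I⊕ i j t = trans (sum-cong-≋ λ m → distribʳ (t m) (I i m) (I j m))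
    (trans (∑-distrib-+ (λ m → I i m * t m) (λ m → I j m * t m)) (+-cong (sum-Iˡ i t) (sum-Iˡ j t)))

  module _ {L M : Matrix ℝ p} (LM≃I : L ⊛ M ≃ I) where

    inverse-I⊕-row : ∀ {i j} → L i ≡ I⊕ i j → ∀ b → M i b + M j b ≈ I i b
    inverse-I⊕-row {i} {j} eq b = trans (sym (sum-I⊕ i j (λ m → M m b)))
      (trans (reflexive (≡.cong (λ t → sum (λ m → t m * M m b)) (≡.sym eq))) (LM≃I i b))

    inverse-I-row : ∀ {i} → L i ≡ I i → ∀ b → M i b ≈ I i b
    inverse-I-row {i} eq b = trans (sym (sum-Iˡ i (λ m → M m b)))
      (trans (reflexive (≡.cong (λ t → sum (λ m → t m * M m b)) (≡.sym eq))) (LM≃I i b))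

  module _ (L : Matrix ℝ p) where

    gram-entry : ∀ a b → (L ⊛ I ⊛ L ᵗ) a b ≈ sum (λ m → L a m * L b m)
    gram-entry a b = trans (congruence-entry L I (λ i j → I-off) a b)
      (sum-cong-≋ λ m → trans (*-congʳ (I-diagonal m)) (*-identityˡ (L a m * L b m)))

    gram-I⊕-row : ∀ {i j} → L i ≡ I⊕ i j → ∀ b → (L ⊛ I ⊛ L ᵗ) i b ≈ L b i + L b j
    gram-I⊕-row {i} {j} eq b = trans (gram-entry i b)
      (trans (reflexive (≡.cong (λ t → sum (λ m → t m * L b m)) eq)) (sum-I⊕ i j (L b)))

    gram-I-row : ∀ {a} → L a ≡ I a → ∀ b → (L ⊛ I ⊛ L ᵗ) a b ≈ L b a
    gram-I-row {a} eq b = trans (gram-entry a b)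
      (trans (reflexive (≡.cong (λ t → sum (λ m → t m * L b m)) eq)) (sum-Iˡ a (L b)))

    gram-sym : L ⊛ I ⊛ L ᵗ ≃ (L ⊛ I ⊛ L ᵗ) ᵗ
    gram-sym = congruence-sym L I (λ i j → I-off)

  zerosPreserved⇒nested : ZerosPreserved ℝ G σ → Nested
  zerosPreserved⇒nested zerosPreserved {i} {j} {k} j<i ij jk k≢i with Adj? i k
  ... | yes ik = ik
  ... | no ¬ik with Fin.<-cmp k j
  ...   | tri≈ _ ≡.refl _ = contradiction jk E-irrefl
  ...   | tri< k<j _ _ = ⊥-elim (1≉0 (begin
          1#                     ≈⟨ proj₂ M-unitLower k ⟨
          M k k                  ≈⟨ +-identityˡ _ ⟨
          0# + M k k             ≈⟨ +-congʳ M≈0 ⟨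
          M j k + M k k          ≈⟨ inverse-I⊕-row {L} {M} LM≃I withRows-second k ⟩
          I j k                  ≈⟨ I-off (Adj⇒≢ jk) ⟩
          0#                     ∎))
    where
    L : Matrix ℝ p
    -- The relations between the rows of the inverse give M_ik = -M_jk = M_kk = 1, so `L` lies in 𝓛
    -- while its inverse does not.
    L = withRows i (I⊕ i j) j (I⊕ j k)

    unitLower : IsUnitLowerTriangular ℝ L
    unitLower = withRows-unitLower (I⊕-unitLower j<i) (I⊕-unitLower k<j)

    inverse = unitLower-inverse L unitLower
    M = proj₁ inverse
    LM≃I = proj₁ (proj₁ (proj₂ inverse))
    M-unitLower = proj₂ (proj₂ inverse)

    M∈𝓛 : 𝓛 ℝ G σ M
    M∈𝓛 = Equivalence.to
      (proj₁ (zerosPreserved I L M I-positiveDiagonal unitLower (proj₁ (proj₂ inverse))))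
      (unitLower , λ a b b<a ¬ab →
        withRows-zeroOffEdges {i} {I⊕ i j} {j} {I⊕ j k} (I⊕-zeroOffEdges ij) (I⊕-zeroOffEdges jk)
          a b (Fin.<⇒≢ b<a ∘ ≡.sym) ¬ab)

    M≈0 : M j k ≈ 0#
    M≈0 = begin
      M j k          ≈⟨ +-identityˡ _ ⟨
      0# + M j k     ≈⟨ +-congʳ (proj₂ M∈𝓛 i k (ℕ.<-trans k<j j<i) ¬ik) ⟨
      M i k + M j k  ≈⟨ inverse-I⊕-row {L} {M} LM≃I (withRows-first (Adj⇒≢ ij)) k ⟩
      I i k          ≈⟨ I-off (k≢i ∘ ≡.sym) ⟩
      0#             ∎
  ...   | tri> _ _ j<k = ⊥-elim (1≉0 (begin
          1#                       ≈⟨ trans (+-congʳ (+-identityˡ _)) (+-identityˡ _) ⟨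
          0# + 0# + 1#             ≈⟨ +-assoc _ _ _ ⟩
          0# + (0# + 1#)           ≈⟨ +-cong Lki≈0 Lkj≈1 ⟨
          L k i + L k j            ≈⟨ gram-I⊕-row L (withRows-first (k≢i ∘ ≡.sym)) k ⟨
          (L ⊛ I ⊛ L ᵗ) i k        ≈⟨ proj₂ (proj₂ S∈𝓟) i k (k≢i ∘ ≡.sym) ¬ik ⟩
          0#                       ∎))
    where
    L : Matrix ℝ p
    -- Rows i and k overlap exactly in column j, so the entry of LLᵀ at (i, k) is 1, in whichever
    -- order i and k stand.
    L = withRows i (I⊕ i j) k (I⊕ k j)

    kj : Adj k j
    kj = E-sym jk

    unitLower : IsUnitLowerTriangular ℝ L
    unitLower = withRows-unitLower (I⊕-unitLower j<i) (I⊕-unitLower j<k)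

    inverse = unitLower-inverse L unitLower
    M = proj₁ inverse

    S∈𝓟 : 𝓟 ℝ G σ (L ⊛ I ⊛ L ᵗ)
    S∈𝓟 =
      let L⇔M , M⇔S = zerosPreserved I L M I-positiveDiagonal unitLower (proj₁ (proj₂ inverse))
      in Equivalence.to M⇔S (Equivalence.to L⇔M (unitLower , λ a b b<a ¬ab →
        withRows-zeroOffEdges {i} {I⊕ i j} {k} {I⊕ k j} (I⊕-zeroOffEdges ij) (I⊕-zeroOffEdges kj)
          a b (Fin.<⇒≢ b<a ∘ ≡.sym) ¬ab))

    Lki≈0 : L k i ≈ 0#
    Lki≈0 = trans (reflexive (≡.cong (λ t → t i) (withRows-second {i} {k})))
      (trans (+-cong (I-off k≢i) (I-off (Fin.<⇒≢ j<i))) (+-identityʳ _))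

    Lkj≈1 : L k j ≈ 0# + 1#
    Lkj≈1 = trans (reflexive (≡.cong (λ t → t j) (withRows-second {i} {k})))
      (+-cong (I-off (Adj⇒≢ kj)) (I-diagonal j))

  -- Row i of L⁻¹ equals −(row j) off column i, so on a maximal clique C
  -- containing j and k but not i the inverse of LLᵀ is UᵀEU, where U = (L⁻¹)_C
  -- and E is the identity except for E_jj = 2; its determinant is 2, not 1.
  cliqueDeterminants-refuted : CliqueDeterminants ℝ G σ → ∀ {L i j k} →
    IsUnitLowerTriangular ℝ L → ZeroOffEdges (L ⊛ I ⊛ L ᵗ) →
    Adj i j → Adj j k → k ≢ i → ¬ Adj i k →
    L i ≡ I⊕ i j → (∀ {m} → m ≢ i → m ≢ j → m ≢ k → L m ≡ I m) → ⊥
  cliqueDeterminants-refuted cliqueDeterminants {L} {i} {j} {k} unitLower S≈0 ij jk k≢i ¬ik L-i L-other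
    with unitLower-inverse L unitLower | clique⊆maximalClique _ (pair-clique jk)
  ... | M , L-inverse@(LM≃I , _) , M-unitLower | C , C-maximal , ⊆C = 1≉0 (+-identityˡ-unique 1# 1# (begin
    1# + 1#
      ≈⟨ Ej≈2 ⟨
    E′ j
      ≡⟨ ≡.cong E′ (proj₂ j-element) ⟨
    E′ (elements C′ (proj₁ j-element))
      ≈⟨ product-single (proj₁ j-element) (λ l l≢ → E≈1 l λ eq →
           l≢ (elements-injective C′ (≡.trans eq (≡.sym (proj₂ j-element))))) ⟨
    product (E′ ∘ elements C′)
      ≈⟨ det-principal C′ {T} {M} E′ M-unitLower T≈ vanish ⟨
    det ℝ (principal ℝ T C′)
      ≈⟨ cliqueDeterminants (L ⊛ I ⊛ L ᵗ) T L I
           (congruence-𝓟 {L} {I} {M} I-positiveDiagonal LM≃I S≈0)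
           (congruence-inverse {S = L ⊛ I ⊛ L ᵗ} {L} {I} {M} (λ _ → 1#)
             (λ _ _ → refl) L-inverse (λ _ _ → I-off)
             (λ a → trans (*-identityʳ _) (I-diagonal a)))
           (unitLower , I-positiveDiagonal , λ _ _ → refl) C C-maximal ⟩
    product (λ l → reciprocal ℝ (proj₂ I-positiveDiagonal (elements C′ l)))
      ≈⟨ product-one (λ l → reciprocal≈1 (elements C′ l)) ⟩
    1# ∎))
    where
    C′ = image G σ C

    j∈C : lookup C′ j ≡ true
    j∈C = lookup-image⁺ C (⊆C (insert-self {vtx j} {insert (vtx k) (const false)}))

    k∈C : lookup C′ k ≡ true
    k∈C = lookup-image⁺ C (⊆C (insert-⊇ {vtx j} {insert (vtx k) (const false)}
      (insert-self {vtx k} {const false})))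

    i∉C : lookup C′ i ≢ true
    i∉C i∈C = ¬ik (proj₁ C-maximal (vtx i) (vtx k) (lookup-image⁻ C i∈C) (lookup-image⁻ C k∈C)
      (k≢i ∘ ≡.sym ∘ vtx-injective))

    j-element = elements-surjective C′ j∈C

    T : Matrix ℝ p
    T a b = sum (λ m → 1# * (M m a * M m b))

    -- On C the rows i and j of `M` are opposite, so they contribute equally to `T` and the weight
    -- of row i can be moved onto row j. Row i lies outside C without vanishing on it; its new
    -- weight 0 removes it from the sum.
    E′ : Vector Carrier p
    E′ m = 1# + (I j m - I i m)

    Ej≈2 : E′ j ≈ 1# + 1#
    Ej≈2 = +-congˡ (trans (+-cong (I-diagonal j) (trans (-‿cong (I-off (Adj⇒≢ ij))) -0#≈0#)) (+-identityʳ _))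

    Ei≈0 : E′ i ≈ 0#
    Ei≈0 = trans (+-congˡ (trans (+-cong (I-off (Adj⇒≢ ij ∘ ≡.sym)) (-‿cong (I-diagonal i))) (+-identityˡ _)))
      (-‿inverseʳ 1#)

    E≈1 : ∀ l → elements C′ l ≢ j → E′ (elements C′ l) ≈ 1#
    E≈1 l ≢j = trans (+-congˡ (trans (+-cong (I-off (≢j ∘ ≡.sym))
      (trans (-‿cong (I-off i≢)) -0#≈0#)) (+-identityʳ _)))
      (+-identityʳ _)
      where
      i≢ : i ≢ elements C′ l
      i≢ eq = i∉C (≡.subst (λ m → lookup C′ m ≡ true) (≡.sym eq) (elements-member C′ l))

    M-i : ∀ {a} → lookup C′ a ≡ true → M i a ≈ - M j a
    M-i {a} a∈C = +-inverseˡ-unique (M i a) (M j a)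
      (trans (inverse-I⊕-row {L} {M} LM≃I L-i a) (I-off {i = i} {a} λ { ≡.refl → i∉C a∈C }))

    vanish : ∀ {m a} → lookup C′ m ≢ true → lookup C′ a ≡ true → E′ m * M m a ≈ 0#
    vanish {m} {a} m∉C a∈C with m Fin.≟ i
    ... | yes ≡.refl = trans (*-congʳ Ei≈0) (zeroˡ _)
    -- As j and k belong to C, a row m ≠ i outside C is an identity row of `L`, and hence of `M`.
    ... | no m≢i = trans (*-congˡ (trans
      (inverse-I-row {L} {M} LM≃I (L-other m≢i (λ { ≡.refl → m∉C j∈C }) (λ { ≡.refl → m∉C k∈C })) a)
      (I-off {i = m} {a} λ { ≡.refl → m∉C a∈C }))) (zeroʳ _)

    T≈ : ∀ {a b} → lookup C′ a ≡ true → lookup C′ b ≡ true → T a b ≈ sum (λ m → E′ m * (M m a * M m b))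
    T≈ {a} {b} a∈C b∈C = sym (begin
      sum (λ m → E′ m * f m)
        ≈⟨ sum-cong-≋ (λ m → trans (distribʳ (f m) 1# _) (+-congˡ (distribʳ (f m) (I j m) (- I i m)))) ⟩
      sum (λ m → 1# * f m + (I j m * f m + - I i m * f m))
        ≈⟨ ∑-distrib-+ (λ m → 1# * f m) (λ m → I j m * f m + - I i m * f m) ⟩
      T a b + sum (λ m → I j m * f m + - I i m * f m)
        ≈⟨ +-congˡ (∑-distrib-+ (λ m → I j m * f m) (λ m → - I i m * f m)) ⟩
      T a b + (sum (λ m → I j m * f m) + sum (λ m → - I i m * f m))
        ≈⟨ +-congˡ (+-cong (sum-Iˡ j f) (sum-cong-≋ λ m → swap-neg (I i m) (f m))) ⟩
      T a b + (f j + sum (λ m → I i m * - f m))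
        ≈⟨ +-congˡ (+-cong fj≈fi (sum-Iˡ i (λ m → - f m))) ⟩
      T a b + (f i - f i)
        ≈⟨ trans (+-congˡ (-‿inverseʳ (f i))) (+-identityʳ _) ⟩
      T a b ∎)
      where
      f : Vector Carrier p
      f m = M m a * M m b

      swap-neg : ∀ x y → - x * y ≈ x * - y
      swap-neg x y = trans (sym (-‿distribˡ-* x y)) (-‿distribʳ-* x y)

      fj≈fi : f j ≈ f i
      fj≈fi = sym (begin
        M i a * M i b        ≈⟨ *-cong (M-i a∈C) (M-i b∈C) ⟩
        - M j a * - M j b    ≈⟨ swap-neg (M j a) (- M j b) ⟩
        M j a * - - M j b    ≈⟨ *-congˡ (-‿involutive (M j b)) ⟩
        M j a * M j b        ∎)

    reciprocal≈1 : ∀ a → reciprocal ℝ (proj₂ I-positiveDiagonal a) ≈ 1#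
    reciprocal≈1 a = trans (sym (*-identityˡ _)) (trans (*-congʳ (sym (I-diagonal a)))
      (*-reciprocal (proj₂ I-positiveDiagonal a)))

  -- If row a of L is an identity row, the entry of LLᵀ at (a, b) is just L_ba, so only (i, k) mixes
  -- two altered rows. Columns i and k of L are exempt from the hypothesis, which leaves room for a
  -- correcting entry at the nonadjacent pair (k, i).
  gram-zeroOffEdges : ∀ {i x k y} → i ≢ k → let L = withRows i x k y in
    (∀ a b → a ≢ b → ¬ Adj a b → b ≢ i → b ≢ k → L a b ≈ 0#) →
    (¬ Adj i k → (L ⊛ I ⊛ L ᵗ) i k ≈ 0#) → ZeroOffEdges (L ⊛ I ⊛ L ᵗ)
  gram-zeroOffEdges {i} {x} {k} {y} i≢k L≈0 S-ik a b a≢b ¬ab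
    with plain? a | plain? b
    where
    plain? : ∀ a → (a ≢ i × a ≢ k) ⊎ (a ≡ i ⊎ a ≡ k)
    plain? a with a Fin.≟ i | a Fin.≟ k
    ... | yes a≡i | _ = inj₂ (inj₁ a≡i)
    ... | no _ | yes a≡k = inj₂ (inj₂ a≡k)
    ... | no a≢i | no a≢k = inj₁ (a≢i , a≢k)
  ... | inj₁ (a≢i , a≢k) | _ = trans (gram-I-row (withRows i x k y) (withRows-other a≢i a≢k) b)
    (L≈0 b a (a≢b ∘ ≡.sym) (¬ab ∘ E-sym) a≢i a≢k)
  ... | inj₂ _ | inj₁ (b≢i , b≢k) = trans (gram-sym (withRows i x k y) a b)
    (trans (gram-I-row (withRows i x k y) (withRows-other b≢i b≢k) a) (L≈0 a b a≢b ¬ab b≢i b≢k))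
  ... | inj₂ (inj₁ ≡.refl) | inj₂ (inj₁ ≡.refl) = contradiction ≡.refl a≢b
  ... | inj₂ (inj₁ ≡.refl) | inj₂ (inj₂ ≡.refl) = S-ik ¬ab
  ... | inj₂ (inj₂ ≡.refl) | inj₂ (inj₁ ≡.refl) =
    trans (gram-sym (withRows i x k y) k i) (S-ik (¬ab ∘ E-sym))
  ... | inj₂ (inj₂ ≡.refl) | inj₂ (inj₂ ≡.refl) = contradiction ≡.refl a≢b

  -- The altered rows are those of i and j, which are adjacent, so the entry of LLᵀ where they meet
  -- is unconstrained. Row k remains an identity row, whence the entry at (i, k) is L_ik = 0.
  cliqueDeterminants⇒transitive : CliqueDeterminants ℝ G σ →
    ∀ {i j k} → k Fin.< j → j Fin.< i → Adj i j → Adj j k → Adj i k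
  cliqueDeterminants⇒transitive cliqueDeterminants {i} {j} {k} k<j j<i ij jk with Adj? i k
  ... | yes ik = ik
  ... | no ¬ik = ⊥-elim (cliqueDeterminants-refuted cliqueDeterminants
    (withRows-unitLower (I⊕-unitLower j<i) (I⊕-unitLower k<j))
    (gram-zeroOffEdges (Adj⇒≢ ij)
      (λ a b a≢b ¬ab _ _ → withRows-zeroOffEdges {i} {I⊕ i j} {j} {I⊕ j k}
        (I⊕-zeroOffEdges ij) (I⊕-zeroOffEdges jk) a b a≢b ¬ab)
      (contradiction ij))
    ij jk (Fin.<⇒≢ (ℕ.<-trans k<j j<i)) ¬ik
    (withRows-first (Adj⇒≢ ij)) (λ m≢i m≢j _ → withRows-other m≢i m≢j))

  -- The entry −1 at (k , i) cancels the fill-in that j creates between i and k.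
  cliqueDeterminants⇒no-fill : CliqueDeterminants ℝ G σ →
    ∀ {i j k} → j Fin.< i → i Fin.< k → Adj i j → Adj k j → Adj i k
  cliqueDeterminants⇒no-fill cliqueDeterminants {i} {j} {k} j<i i<k ij kj with Adj? i k
  ... | yes ik = ik
  ... | no ¬ik = ⊥-elim (cliqueDeterminants-refuted cliqueDeterminants
    (withRows-unitLower (I⊕-unitLower j<i) y-unitLower)
    (gram-zeroOffEdges i≢k (withRows-all {i} {k} {I⊕ i j} {y}
        (λ a t → ∀ b → a ≢ b → ¬ Adj a b → b ≢ i → b ≢ k → t b ≈ 0#)
        (λ b i≢b ¬ib _ _ → I⊕-zeroOffEdges ij b i≢b ¬ib)
        (λ b k≢b ¬kb b≢i _ → y-zero k≢b (λ { ≡.refl → ¬kb kj }) (b≢i ∘ ≡.sym))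
        (λ a _ _ b a≢b _ _ _ → I-off a≢b))
      (λ _ → S-ik))
    ij (E-sym kj) (i≢k ∘ ≡.sym) ¬ik
    (withRows-first i≢k) (λ m≢i _ m≢k → withRows-other m≢i m≢k))
    where
    i≢k : i ≢ k
    i≢k = Fin.<⇒≢ i<k

    y : Vector Carrier p
    y m = I k m + (I j m - I i m)

    y-zero : ∀ {b} → k ≢ b → j ≢ b → i ≢ b → y b ≈ 0#
    y-zero k≢b j≢b i≢b = trans (+-cong (I-off k≢b)
      (trans (+-cong (I-off j≢b) (trans (-‿cong (I-off i≢b)) -0#≈0#)) (+-identityʳ _))) (+-identityʳ _)

    y-unitLower : UnitLowerRow k y
    y-unitLower =
      (λ b k<b → y-zero (Fin.<⇒≢ k<b) (Fin.<⇒≢ (ℕ.<-trans j<i (ℕ.<-trans i<k k<b)))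
        (Fin.<⇒≢ (ℕ.<-trans i<k k<b))) ,
      trans (+-cong (I-diagonal k) (trans (+-cong (I-off (Adj⇒≢ kj ∘ ≡.sym))
        (trans (-‿cong (I-off i≢k)) -0#≈0#)) (+-identityʳ _))) (+-identityʳ _)

    L : Matrix ℝ p
    L = withRows i (I⊕ i j) k y

    S-ik : (L ⊛ I ⊛ L ᵗ) i k ≈ 0#
    S-ik = begin
      (L ⊛ I ⊛ L ᵗ) i k
        ≈⟨ gram-I⊕-row L (withRows-first i≢k) k ⟩
      L k i + L k j
        ≡⟨ ≡.cong (λ t → t i + t j) (withRows-second {i} {k} {I⊕ i j} {y}) ⟩
      I k i + (I j i - I i i) + (I k j + (I j j - I i j))
        ≈⟨ +-cong
             (+-cong (I-off (i≢k ∘ ≡.sym)) (+-cong (I-off (Fin.<⇒≢ j<i)) (-‿cong (I-diagonal i))))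
             (+-cong (I-off (Adj⇒≢ kj)) (+-cong (I-diagonal j) (-‿cong (I-off (Adj⇒≢ ij))))) ⟩
      0# + (0# - 1#) + (0# + (1# - 0#))
        ≈⟨ +-cong (trans (+-identityˡ _) (+-identityˡ _)) (trans (+-identityˡ _) (x-0≈x 1#)) ⟩
      - 1# + 1#
        ≈⟨ -‿inverseˡ 1# ⟩
      0# ∎

  cliqueDeterminants⇒nested : CliqueDeterminants ℝ G σ → Nested
  cliqueDeterminants⇒nested cliqueDeterminants {i} {j} {k} j<i ij jk k≢i with Fin.<-cmp k j
  ... | tri≈ _ ≡.refl _ = contradiction jk E-irrefl
  ... | tri< k<j _ _ = cliqueDeterminants⇒transitive cliqueDeterminants k<j j<i ij jk
  ... | tri> _ _ j<k with Fin.<-cmp i k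
  ...   | tri< i<k _ _ = cliqueDeterminants⇒no-fill cliqueDeterminants j<i i<k ij (E-sym jk)
  ...   | tri≈ _ i≡k _ = contradiction (≡.sym i≡k) k≢i
  -- A correcting entry -1 must lie below the diagonal, in the row of the later of i and k. The path
  -- is symmetric in its ends, so they exchange roles here.
  ...   | tri> _ _ k<i = E-sym (cliqueDeterminants⇒no-fill cliqueDeterminants j<k k<i (E-sym jk) ij)

theorem1 : ∀ {c ℓ₁ ℓ₂ ℓ₃ v e} (ℝ : Reals c ℓ₁ ℓ₂ ℓ₃)
    {V : Set v} (G : Graph V e) {p : ℕ} (σ : Ordering V p) →
    ((Graph.IsHomogeneous G × IsHasseTreeScheme G σ) ⇔ ZerosPreserved ℝ G σ)
    × (ZerosPreserved ℝ G σ ⇔ CliqueDeterminants ℝ G σ)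
theorem1 ℝ G σ =
  mk⇔ (λ (homogeneous , hasse) → nested⇒zerosPreserved (homogeneous∧hasse⇒nested homogeneous hasse))
      (λ zerosPreserved → let nested = zerosPreserved⇒nested zerosPreserved in
        (λ u w → nested⇒homogeneous nested u w) , λ u w → nested⇒hasse nested u w) ,
  mk⇔ (λ zerosPreserved → nested⇒cliqueDeterminants (zerosPreserved⇒nested zerosPreserved))
      (λ cliqueDeterminants → nested⇒zerosPreserved (cliqueDeterminants⇒nested cliqueDeterminants))
  where
  open OrderedGraph G σ
  open Equivalences ℝ G σ
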